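{- Let $V$ be a group-like set. The following are equivalent: (1) the category $\mathcal{M}_V$ is directed; (2) $\mathrm{Homeo}(2^{\mathbb{N}},\mu_V)$ has the Rokhlin property, i.e. it admits a dense conjugacy class.
   Context: All measures are Borel probability measures; $2^{\mathbb{N}}$ is the Cantor space. A measure is full if it is positive on every nonempty open set; the clopen values set of $\mu$ is $V_\mu=\{\mu(U): U\text{ clopen}\}$. A full measure $\mu$ on $2^{\mathbb{N}}$ is good if whenever $U,W$ are clopen with $\mu(U)<\mu(W)$, there is a clopen $W'\subseteq W$ with $\mu(W')=\mu(U)$. A set $V$ is group-like if it is countably infinite, $\{0,1\}\subseteq V\subseteq[0,1]$, and $V+\mathbb{Z}$ is an additive subgroup of $\mathbb{R}$. For group-like $V$, $\mu_V$ denotes the good measure on $2^{\mathbb{N}}$ with clopen values set $V$ (it exists and is unique up to homeomorphism). $\mathrm{Homeo}(2^{\mathbb{N}},\mu_V)$ is the Polish group (compact-open topology) of homeomorphisms of $2^{\mathbb{N}}$ preserving $\mu_V$. A clopen partition is a finite partition of $2^{\mathbb{N}}$ into nonempty clopen sets. For clopen partitions $P,R$, a $\mu_V$-morphism $R\to P$ is a surjection $p\colon R\to P$ with $\mu_V(x)=\sum_{y\in p^{ -1}(\{x\})}\mu_V(y)$ for all $x\in P$. The category $\mathcal{M}_V$: objects are matrices $A=(a_{p,p'})_{p,p'\in P}$ with entries in $V$, indexed by a clopen partition $P=P_A$ of $2^{\mathbb{N}}$, such that $\sum_{p'\in P}a_{p,p'}=\sum_{p'\in P}a_{p',p}=\mu_V(p)$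 for all $p\in P$ (so all entries sum to $1$). A morphism from $B=(b_{q,q'})_{q,q'\in Q}$ to $A=(a_{p,p'})_{p,p'\in P}$ is a $\mu_V$-morphism $f\colon Q\to P$ such that $a_{p,p'}=\sum_{q\in f^{ -1}(p),\,q'\in f^{ -1}(p')}b_{q,q'}$ for all $p,p'\in P$. A category is directed if for any two objects $A_0,A_1$ there are an object $B$ and morphisms $B\to A_0$, $B\to A_1$. -}

module Defs where

open import Algebra.Bundles using (CommutativeRing; Group)
import Algebra.Definitions.RawMonoid as RawMonoid
open import Data.Bool.Base using (Bool; if_then_else_)
open import Data.Fin.Base using (Fin)
import Data.Fin.Properties as Fin
open import Data.List.Base using (List)
open import Data.List.Relation.Unary.All using (All)
open import Data.List.Relation.Unary.Any using (Any)
open import Data.Nat.Base as ℕ using (ℕ)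
import Data.Nat.Properties as ℕ
open import Data.Product.Base using (∃; ∃-syntax; _×_; _,_; proj₁; proj₂)
open import Function.Base using (_∘_; _on_; id)
open import Function.Definitions using (Bijective; Surjective)
open import Level using (Level; 0ℓ; _⊔_) renaming (suc to lsuc)
open import Relation.Binary.Core using (Rel)
open import Relation.Binary.Definitions using (_Respects_)
open import Relation.Binary.PropositionalEquality.Core as ≡ using (_≡_; _≢_; _≗_)
open import Relation.Binary.Structures using (IsTotalOrder)
open import Relation.Nullary.Decidable.Core using (does)
open import Relation.Nullary.Negation.Core using (¬_)
open import Relation.Unary
  using (Pred; _∈_; _⊆_; _≐_; _≬_; _⊥_; _⊢_; ∅; U; ∁; ⋃; Universal; Satisfiable)

------------------------------------------------------------------------
-- The real numbers

-- The standard library has no real numbers.  They are given by their usual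
-- axioms (a Dedekind complete ordered field), which determine them up to
-- unique isomorphism.  Assuming excluded middle, decidable Dedekind cuts of
-- rationals are a model at this universe level.

record CompleteOrderedField : Set₁ where
  infix 4 _≤_ _<_
  field
    commutativeRing : CommutativeRing 0ℓ 0ℓ

  open CommutativeRing commutativeRing public

  field
    _≤_          : Rel Carrier 0ℓ
    isTotalOrder : IsTotalOrder _≈_ _≤_
    0≉1          : ¬ (0# ≈ 1#)
    inverse      : ∀ x → ¬ (x ≈ 0#) → ∃[ y ] x * y ≈ 1#
    +-monoˡ-≤    : ∀ z {x y} → x ≤ y → x + z ≤ y + z
    *-nonNeg     : ∀ {x y} → 0# ≤ x → 0# ≤ y → 0# ≤ x * y

  UpperBound : Pred Carrier 0ℓ → Pred Carrier 0ℓ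
  UpperBound S b = ∀ {x} → x ∈ S → x ≤ b

  field
    supremum : (S : Pred Carrier 0ℓ) → Satisfiable S → Satisfiable (UpperBound S) →
               ∃[ s ] (s ∈ UpperBound S × (∀ {b} → b ∈ UpperBound S → s ≤ b))

  _<_ : Rel Carrier 0ℓ
  x < y = x ≤ y × ¬ (x ≈ y)

  open RawMonoid +-rawMonoid public using (sum) renaming (_×_ to _·_)

  ∑< : ℕ → (ℕ → Carrier) → Carrier
  ∑< ℕ.zero    a = 0#
  ∑< (ℕ.suc n) a = ∑< n a + a n

  ConvergesTo : (ℕ → Carrier) → Carrier → Set
  ConvergesTo a l = ∀ ε → 0# < ε →
    ∃[ N ] ∀ n → N ℕ.≤ n → (l + - ε < a n) × (a n < l + ε)

  -- The sum of b q over all q in the fibre of f over p.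
  ∑-fibre : ∀ {m k} → (Fin m → Fin k) → Fin k → (Fin m → Carrier) → Carrier
  ∑-fibre f p b = sum (λ q → if does (f q Fin.≟ p) then b q else 0#)

------------------------------------------------------------------------
-- Group-like sets

module _ (ℝ : CompleteOrderedField) where
  open CompleteOrderedField ℝ

  infix 8 _+ℤ

  _+ℤ : Pred Carrier 0ℓ → Pred Carrier 0ℓ
  (V +ℤ) x = ∃[ v ] ∃[ m ] ∃[ n ] (v ∈ V × x ≈ v + (m · 1# + - (n · 1#)))

  record IsAdditiveSubgroup (H : Pred Carrier 0ℓ) : Set where
    field
      0-closed : 0# ∈ H
      +-closed : ∀ {x y} → x ∈ H → y ∈ H → x + y ∈ H
      --closed : ∀ {x} → x ∈ H → - x ∈ H

  CountablyInfinite : Pred Carrier 0ℓ → Set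
  CountablyInfinite V = ∃ λ (e : ℕ → ∃ V) → Bijective _≡_ (_≈_ on proj₁) e

  record IsGroupLike (V : Pred Carrier 0ℓ) : Set where
    field
      -- Elements of the carrier are identified up to _≈_, so a subset must
      -- be invariant under it.
      respects          : V Respects _≈_
      countablyInfinite : CountablyInfinite V
      0∈V               : 0# ∈ V
      1∈V               : 1# ∈ V
      V⊆[0,1]           : ∀ {x} → x ∈ V → 0# ≤ x × x ≤ 1#
      V+ℤ-subgroup      : IsAdditiveSubgroup (V +ℤ)

------------------------------------------------------------------------
-- The Cantor space

-- Points are identified up to pointwise equality _≗_; open sets, Borel sets
-- and continuous maps automatically respect it.

Cantor : Set
Cantor = ℕ → Bool

cylinder : Cantor → ℕ → Pred Cantor 0ℓ
cylinder x n y = ∀ i → i ℕ.< n → x i ≡ y i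

IsOpen : Pred Cantor 0ℓ → Set
IsOpen O = ∀ {x} → x ∈ O → ∃[ n ] cylinder x n ⊆ O

record Clopen : Set₁ where
  field
    set      : Pred Cantor 0ℓ
    isOpen   : IsOpen set
    isClosed : IsOpen (∁ set)

open Clopen public using (set)

IsCompact : Pred Cantor 0ℓ → Set₁
IsCompact K = ∀ (I : Set) (O : I → Pred Cantor 0ℓ) → (∀ i → IsOpen (O i)) →
  K ⊆ ⋃ I O → ∃ λ (is : List I) → ∀ {x} → x ∈ K → Any (λ i → x ∈ O i) is

data IsBorel : Pred Cantor 0ℓ → Set₁ where
  open-set   : ∀ {O} → IsOpen O → IsBorel O
  complement : ∀ {B} → IsBorel B → IsBorel (∁ B)
  union      : ∀ {B : ℕ → Pred Cantor 0ℓ} → (∀ n → IsBorel (B n)) → IsBorel (⋃ ℕ B)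
  resp       : ∀ {B C} → B ≐ C → IsBorel B → IsBorel C

IsContinuous : (Cantor → Cantor) → Set₁
IsContinuous f = ∀ {O} → IsOpen O → IsOpen (f ⊢ O)

cylinder-open : ∀ x n → IsOpen (cylinder x n)
cylinder-open x n y∈ = n , λ z∈ i i<n → ≡.trans (y∈ i i<n) (z∈ i i<n)

continuous-cong : ∀ {f} → IsContinuous f → ∀ {x y} → x ≗ y → f x ≗ f y
continuous-cong {f} cont {x} x≗y i =
  proj₂ (cont (cylinder-open (f x) (ℕ.suc i)) {x} (λ _ _ → ≡.refl))
    (λ j _ → x≗y j) i ℕ.≤-refl

preimage-borel : ∀ {f} → IsContinuous f → ∀ {B} → IsBorel B → IsBorel (f ⊢ B)
preimage-borel cont (open-set o)          = open-set (cont o)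
preimage-borel cont (complement b)        = complement (preimage-borel cont b)
preimage-borel cont (union b)             = union (λ n → preimage-borel cont (b n))
preimage-borel cont (resp (B⊆C , C⊆B) b)  = resp (B⊆C , C⊆B) (preimage-borel cont b)

borel-cong : ∀ {B} → IsBorel B → ∀ {x y} → x ≗ y → x ∈ B → y ∈ B
borel-cong (open-set o)         x≗y x∈           = proj₂ (o x∈) (λ i _ → x≗y i)
borel-cong (complement b)       x≗y x∉ y∈        = x∉ (borel-cong b (≡.sym ∘ x≗y) y∈)
borel-cong (union b)            x≗y (n , x∈)     = n , borel-cong (b n) x≗y x∈
borel-cong (resp (B⊆C , C⊆B) b) x≗y x∈           = B⊆C (borel-cong b x≗y (C⊆B x∈))

------------------------------------------------------------------------
-- Borel probability measures

module _ (ℝ : CompleteOrderedField) where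
  open CompleteOrderedField ℝ

  record ProbabilityMeasure : Set₁ where
    field
      measure    : ∀ {B} → IsBorel B → Carrier
      cong       : ∀ {B C} (b : IsBorel B) (c : IsBorel C) → B ≐ C → measure b ≈ measure c
      nonNeg     : ∀ {B} (b : IsBorel B) → 0# ≤ measure b
      empty      : (b : IsBorel ∅) → measure b ≈ 0#
      total      : (b : IsBorel U) → measure b ≈ 1#
      σ-additive : ∀ {B : ℕ → Pred Cantor 0ℓ} (b : ∀ n → IsBorel (B n)) →
                   (∀ m n → m ≢ n → B m ⊥ B n) →
                   ConvergesTo (λ n → ∑< n (λ i → measure (b i))) (measure (union b))

    measureᶜ : Clopen → Carrier
    measureᶜ W = measure (open-set (Clopen.isOpen W))

module _ {ℝ : CompleteOrderedField} (μ : ProbabilityMeasure ℝ) where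
  open CompleteOrderedField ℝ
  open ProbabilityMeasure μ

  IsFull : Set₁
  IsFull = ∀ {O} (o : IsOpen O) → Satisfiable O → 0# < measure (open-set o)

  clopenValues : Pred Carrier (lsuc 0ℓ)
  clopenValues x = ∃[ W ] x ≈ measureᶜ W

  record IsGood : Set₁ where
    field
      full   : IsFull
      subset : ∀ O W → measureᶜ O < measureᶜ W →
               ∃[ W′ ] (set W′ ⊆ set W × measureᶜ W′ ≈ measureᶜ O)

------------------------------------------------------------------------
-- Clopen partitions and the category of matrices

-- A partition is listed without repetition by Fin size; since its pieces are
-- nonempty and disjoint, Fin size is in bijection with the set of pieces.

record ClopenPartition : Set₁ where
  field
    size     : ℕ
    piece    : Fin size → Clopen
    nonempty : ∀ p → Satisfiable (set (piece p))
    disjoint : ∀ p q → p ≢ q → set (piece p) ⊥ set (piece q)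
    cover    : Universal (⋃ (Fin size) (λ p → set (piece p)))

module _ {ℝ : CompleteOrderedField} (μ : ProbabilityMeasure ℝ) where
  open CompleteOrderedField ℝ
  open ProbabilityMeasure μ
  open ClopenPartition

  record PartitionMorphism (R P : ClopenPartition) : Set where
    field
      map        : Fin (size R) → Fin (size P)
      surjective : Surjective _≡_ _≡_ map
      measure-∑  : ∀ p → measureᶜ (piece P p) ≈
                         ∑-fibre map p (λ r → measureᶜ (piece R r))

  record Matrix (V : Pred Carrier 0ℓ) : Set₁ where
    field
      partition : ClopenPartition
    field
      entry     : Fin (size partition) → Fin (size partition) → Carrier
      entry∈V   : ∀ p p′ → entry p p′ ∈ V
      row-∑     : ∀ p → sum (λ p′ → entry p p′) ≈ measureᶜ (piece partition p)
      column-∑  : ∀ p → sum (λ p′ → entry p′ p) ≈ measureᶜ (piece partition p)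

  record MatrixMorphism {V : Pred Carrier 0ℓ} (B A : Matrix V) : Set where
    private
      module A = Matrix A
      module B = Matrix B
    field
      partitionMorphism : PartitionMorphism B.partition A.partition
    open PartitionMorphism partitionMorphism public
    field
      entry-∑ : ∀ p p′ → A.entry p p′ ≈
                ∑-fibre map p (λ q → ∑-fibre map p′ (λ q′ → B.entry q q′))

-- Directedness only involves the objects and the hom-sets of a category.

IsDirected : ∀ {o h} {Obj : Set o} → (Obj → Obj → Set h) → Set (o ⊔ h)
IsDirected Hom = ∀ A₀ A₁ → ∃[ B ] (Hom B A₀ × Hom B A₁)

------------------------------------------------------------------------
-- The group of measure-preserving homeomorphisms

module _ {ℝ : CompleteOrderedField} (μ : ProbabilityMeasure ℝ) where
  open CompleteOrderedField ℝ using (_≈_) renaming (trans to ≈-trans; sym to ≈-sym; refl to ≈-refl)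
  open ProbabilityMeasure μ

  record MeasureHomeo : Set₁ where
    field
      to              : Cantor → Cantor
      from            : Cantor → Cantor
      to-continuous   : IsContinuous to
      from-continuous : IsContinuous from
      to-from         : ∀ x → to (from x) ≗ x
      from-to         : ∀ x → from (to x) ≗ x
      preserves       : ∀ {B} (b : IsBorel B) →
                        measure (preimage-borel to-continuous b) ≈ measure b

  open MeasureHomeo

  infix  4 _≋_
  infixr 9 _∘ᴴ_

  _≋_ : Rel MeasureHomeo 0ℓ
  g ≋ h = ∀ x → to g x ≗ to h x

  idᴴ : MeasureHomeo
  idᴴ = record
    { to              = id
    ; from            = id
    ; to-continuous   = λ o → o
    ; from-continuous = λ o → o
    ; to-from         = λ _ _ → ≡.refl
    ; from-to         = λ _ _ → ≡.refl
    ; preserves       = λ b → cong (preimage-borel (λ o → o) b) b (id , id)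
    }

  _∘ᴴ_ : MeasureHomeo → MeasureHomeo → MeasureHomeo
  g ∘ᴴ h = record
    { to              = to g ∘ to h
    ; from            = from h ∘ from g
    ; to-continuous   = λ o → to-continuous h (to-continuous g o)
    ; from-continuous = λ o → from-continuous g (from-continuous h o)
    ; to-from         = λ x i → ≡.trans
        (continuous-cong (to-continuous g) (to-from h (from g x)) i) (to-from g x i)
    ; from-to         = λ x i → ≡.trans
        (continuous-cong (from-continuous h) (from-to g (to h x)) i) (from-to h x i)
    ; preserves       = λ b →
        let b′ = preimage-borel (to-continuous g) b in
        ≈-trans (cong _ (preimage-borel (to-continuous h) b′) (id , id))
        (≈-trans (preserves h b′) (preserves g b))
    }

  inv : MeasureHomeo → MeasureHomeo
  inv g = record
    { to              = from g
    ; from            = to g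
    ; to-continuous   = from-continuous g
    ; from-continuous = to-continuous g
    ; to-from         = from-to g
    ; from-to         = to-from g
    ; preserves       = λ b →
        let b′ = preimage-borel (from-continuous g) b in
        ≈-trans (≈-sym (preserves g b′))
          (cong (preimage-borel (to-continuous g) b′) b
            ( (λ {x} → borel-cong b (from-to g x))
            , (λ {x} → borel-cong b (≡.sym ∘ from-to g x))))
    }

  Homeo : Group (lsuc 0ℓ) 0ℓ
  Homeo = record
    { Carrier = MeasureHomeo
    ; _≈_     = _≋_
    ; _∙_     = _∘ᴴ_
    ; ε       = idᴴ
    ; _⁻¹     = inv
    ; isGroup = record
      { isMonoid = record
        { isSemigroup = record
          { isMagma = record
            { isEquivalence = record
              { refl  = λ _ _ → ≡.refl
              ; sym   = λ p x i → ≡.sym (p x i)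
              ; trans = λ p q x i → ≡.trans (p x i) (q x i)
              }
            ; ∙-cong = λ {g} {g′} {h} {h′} p q x i → ≡.trans
                (continuous-cong (to-continuous g) (q x) i) (p (to h′ x) i)
            }
          ; assoc = λ _ _ _ _ _ → ≡.refl
          }
        ; identity = (λ _ _ _ → ≡.refl) , (λ _ _ _ → ≡.refl)
        }
      ; inverse = from-to , to-from
      ; ⁻¹-cong = λ {g} {h} p x i → ≡.trans
          (continuous-cong (from-continuous g)
            (λ j → ≡.sym (≡.trans (p (from h x) j) (to-from h x j))) i)
          (from-to g (from h x) i)
      }
    }

  -- Subbasic open sets { g | g(K) ⊆ O } of the compact-open topology.

  record CompactOpen : Set₁ where
    field
      K       : Pred Cantor 0ℓ
      O       : Pred Cantor 0ℓ
      compact : IsCompact K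
      isOpen  : IsOpen O

  ⟦_⟧ : CompactOpen → Pred MeasureHomeo 0ℓ
  ⟦ S ⟧ g = ∀ {x} → x ∈ CompactOpen.K S → to g x ∈ CompactOpen.O S

  ⋂⟦_⟧ : List CompactOpen → Pred MeasureHomeo (lsuc 0ℓ)
  ⋂⟦ Ss ⟧ g = All (λ S → g ∈ ⟦ S ⟧) Ss

  IsOpenᴴ : Pred MeasureHomeo (lsuc 0ℓ) → Set₁
  IsOpenᴴ 𝒪 = ∀ {g} → g ∈ 𝒪 → ∃[ Ss ] (g ∈ ⋂⟦ Ss ⟧ × ⋂⟦ Ss ⟧ ⊆ 𝒪)

module _ {c ℓ o ℓ′ : Level} (G : Group c ℓ) where
  open Group G

  ConjugacyClass : Carrier → Pred Carrier (c ⊔ ℓ)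
  ConjugacyClass g h = ∃[ k ] h ≈ k ∙ g ∙ k ⁻¹

  -- The topology on G is given by its predicate of open sets.

  IsDense : (Pred Carrier o → Set ℓ′) → ∀ {s} → Pred Carrier s → Set _
  IsDense IsOpenᴳ S = ∀ 𝒪 → IsOpenᴳ 𝒪 → Satisfiable 𝒪 → 𝒪 ≬ S

  HasRokhlinProperty : (Pred Carrier o → Set ℓ′) → Set _
  HasRokhlinProperty IsOpenᴳ = ∃[ g ] IsDense IsOpenᴳ (ConjugacyClass g)

{-# OPTIONS --safe #-}

-- For a good measure, two clopen partitions whose pieces have the same measures are matched by
-- a measure-preserving homeomorphism: refine by all coordinates, back and forth.  Hence every
-- matrix A is realised by some h, with a p p′ the measure of p ∩ h⁻¹(p′), and every morphism
-- of partitions is induced by some k.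
--
-- If g has a dense conjugacy class, conjugates of g realise any A₀ and A₁, and the matrix of g
-- on a fine enough partition into cylinders maps to both.  Conversely, if B maps to matrices of
-- h₀ and h₁ on fine partitions, then two conjugates of a realisation of B approximate h₀ and h₁,
-- since a nonempty clopen set has nonzero measure.  So any h₀ can be perturbed, as little as
-- desired, to have a conjugate close to a given h₁, and stably so; iterating over countably
-- many targets h₁, the limit has a dense conjugacy class.

module Submission where

open import Defs
open import Axiom.ExcludedMiddle using (ExcludedMiddle)
open import Function.Bundles using (_⇔_; mk⇔)
open import Level using (0ℓ) renaming (suc to lsuc)
open import Relation.Unary using (Pred; _≐_)

open import Data.Bool.Base using (Bool; true; false; if_then_else_)
open import Data.Bool.Properties using (¬-not)
open import Data.Fin.Base using (Fin; zero; suc; toℕ; combine; funToFin; finToFun)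
import Data.Fin.Properties as Fin
open import Data.List.Base as List using (List; []; _∷_; _++_)
open import Data.List.Relation.Unary.All using ([]; _∷_)
import Data.List.Relation.Unary.All.Properties as All
open import Data.List.Relation.Unary.Any using (Any; here; there)
import Data.List.Relation.Unary.Any.Properties as Any
open import Data.Nat.Base as ℕ using (ℕ; zero; suc; _^_; _⊔_)
import Data.Nat.Properties as ℕ
open import Data.Product.Base as Product using (Σ; Σ-syntax; ∃-syntax; _×_; _,_; proj₁; proj₂)
open import Data.Sum.Base using (_⊎_; inj₁; inj₂; [_,_]′)
open import Function.Base using (_∘_; id)
open import Level using (lift; lower)
open import Relation.Binary.PropositionalEquality
  using (_≡_; _≢_; _≗_; refl; sym; trans; cong; cong₂; subst)
open import Relation.Binary.Definitions using (tri<; tri≈; tri>)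
open import Relation.Binary.Structures using (IsTotalOrder)
open import Relation.Nullary.Decidable
  using (Dec; yes; no; does; map′; decidable-stable; dec-true; dec-false)
open import Relation.Nullary.Negation.Core using (¬_; contradiction)
open import Relation.Unary using (_∈_; _∉_; _⊆_; _⊢_; _⊥_; _∪_; _∩_; ∅; U; ∁; ⋃)

-- Prefixes and locally constant functions

-- Invariance of the measure is demanded on all Borel sets, while every homeomorphism below arises
-- from finite clopen data. It is therefore checked only on sets determined by finitely many
-- coordinates and then extended by the π-λ theorem.
--
-- Clopen partitions are handled as locally constant labellings: common refinement is pairing,
-- pulling back is composition, and a label may have an empty fibre.
--
-- A matrix can be realised because each entry can be cut both out of the piece of its row and out
-- of the piece of its column; a homeomorphism matching the two families of cuts moves exactly the
-- prescribed mass from piece to piece.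
--
-- The dense class comes from an explicit limit. Each stage fixes finitely many bits of a map and of
-- its inverse, so that the limit is again invertible. The targets are countable because, by
-- compactness, the first `N` bits of `h x` are given by a finite table on prefixes of `x`.

cylinder-sym : ∀ {x n y} → cylinder x n y → cylinder y n x
cylinder-sym x~y i i<n = sym (x~y i i<n)

cylinder-trans : ∀ {x n y z} → cylinder x n y → cylinder y n z → cylinder x n z
cylinder-trans x~y y~z i i<n = trans (x~y i i<n) (y~z i i<n)

cylinder-mono : ∀ {x m n y} → m ℕ.≤ n → cylinder x n y → cylinder x m y
cylinder-mono m≤n x~y i i<m = x~y i (ℕ.<-≤-trans i<m m≤n)

bit : Bool → Fin 2
bit false = zero
bit true  = suc zero

bit-injective : ∀ {a b} → bit a ≡ bit b → a ≡ b
bit-injective {false} {false} _ = refl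
bit-injective {true}  {true}  _ = refl

bit-surjective : ∀ i → ∃[ b ] bit b ≡ i
bit-surjective zero       = false , refl
bit-surjective (suc zero) = true , refl

-- The newest bit is outermost, so the children of a node `p` of the binary tree are
-- `combine (bit b) p`, the form in which `fan` recurses. Values in `Fin` allow prefixes to index
-- partitions and finite tables.
prefix : ∀ n → Cantor → Fin (2 ^ n)
prefix zero    x = zero
prefix (suc n) x = combine (bit (x n)) (prefix n x)

prefix⇒cylinder : ∀ n {x y} → prefix n x ≡ prefix n y → cylinder x n y
prefix⇒cylinder (suc n) {x} {y} eq i i<1+n
  with eqˡ , eqʳ ← Fin.combine-injective (bit (x n)) (prefix n x) (bit (y n)) (prefix n y) eq
  with ℕ.m<1+n⇒m<n∨m≡n i<1+n
... | inj₁ i<n  = prefix⇒cylinder n eqʳ i i<n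
... | inj₂ refl = bit-injective eqˡ

cylinder⇒prefix : ∀ n {x y} → cylinder x n y → prefix n x ≡ prefix n y
cylinder⇒prefix zero    x~y = refl
cylinder⇒prefix (suc n) x~y =
  cong₂ combine (cong bit (x~y n ℕ.≤-refl)) (cylinder⇒prefix n (cylinder-mono (ℕ.n≤1+n n) x~y))

prefix-surjective : ∀ n p → ∃[ x ] prefix n x ≡ p
prefix-surjective zero    zero = (λ _ → false) , refl
prefix-surjective (suc n) p
  with i , q , combine≡p ← Fin.combine-surjective {2} {2 ^ n} p
  with b , bit≡i ← bit-surjective i
  with x , prefix≡q ← prefix-surjective n q
  = y , trans (cong₂ combine (trans (cong bit yₙ≡b) bit≡i) (trans (cylinder⇒prefix n y~x) prefix≡q)) combine≡p
  where
  y : Cantor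
  y j = if does (j ℕ.≟ n) then b else x j

  yₙ≡b : y n ≡ b
  yₙ≡b = cong (if_then b else x n) (dec-true (n ℕ.≟ n) refl)

  y~x : cylinder y n x
  y~x j j<n = cong (if_then b else x j) (dec-false (j ℕ.≟ n) (ℕ.<⇒≢ j<n))

record LocallyConstant {A : Set} (f : Cantor → A) : Set where
  constructor locally
  field
    radius : ∀ x → ∃[ n ] (∀ {y} → cylinder x n y → f x ≡ f y)

open LocallyConstant

prefix-lc : ∀ n → LocallyConstant (prefix n)
prefix-lc n = locally λ x → n , cylinder⇒prefix n

coordinate-lc : ∀ i → LocallyConstant (λ x → x i)
coordinate-lc i = locally λ x → suc i , λ x~y → x~y i ℕ.≤-refl

∘-lc : ∀ {A B : Set} {f : Cantor → A} (g : A → B) → LocallyConstant f → LocallyConstant (g ∘ f)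
∘-lc g (locally r) = locally λ x → proj₁ (r x) , cong g ∘ proj₂ (r x)

-- Near `x` the label `f` is frozen at `f x`, so only the single map `g (f x)` matters there. This
-- glues separate labellings of the pieces of a partition.
dependent-lc : ∀ {A B : Set} {f : Cantor → A} {g : A → Cantor → B} →
  LocallyConstant f → (∀ a → LocallyConstant (g a)) → LocallyConstant (λ x → g (f x) x)
dependent-lc {f = f} {g} f-lc g-lc = locally λ x →
  let m , f-const = radius f-lc x
      n , g-const = radius (g-lc (f x)) x
  in m ⊔ n , λ {y} x~y → trans
    (g-const (cylinder-mono (ℕ.m≤n⊔m m n) x~y))
    (cong (λ a → g a y) (f-const (cylinder-mono (ℕ.m≤m⊔n m n) x~y)))

pair-lc : ∀ {A B : Set} {f : Cantor → A} {g : Cantor → B} →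
  LocallyConstant f → LocallyConstant g → LocallyConstant (λ x → f x , g x)
pair-lc {g = g} f-lc g-lc = dependent-lc {g = λ a x → a , g x} f-lc (λ a → ∘-lc (a ,_) g-lc)

-- Continuity tested on finite prefixes, a small type, whereas `IsContinuous` quantifies over all
-- open sets.
Continuous : (Cantor → Cantor) → Set
Continuous f = ∀ n → LocallyConstant (prefix n ∘ f)

continuous : ∀ {f} → Continuous f → IsContinuous f
continuous {f} cont O-open {x} fx∈O =
  let m , fx~⊆O = O-open fx∈O
      n , const = radius (cont m) x
  in n , λ x~y → fx~⊆O (prefix⇒cylinder m (const x~y))

continuous⁻¹ : ∀ {f} → IsContinuous f → Continuous f
continuous⁻¹ {f} cont n = locally λ x →
  let m , const = cont (cylinder-open (f x) n) {x} (λ _ _ → refl)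
  in m , λ x~y → cylinder⇒prefix n (const x~y)

∘-continuous : ∀ {A : Set} {f : Cantor → A} {g} →
  LocallyConstant f → IsContinuous g → LocallyConstant (f ∘ g)
∘-continuous {g = g} f-lc cont = locally λ x →
  let m , const  = radius f-lc (g x)
      n , const′ = cont (cylinder-open (g x) m) {x} (λ _ _ → refl)
  in n , λ x~y → const (const′ x~y)

lc-cong : ∀ {A : Set} {f : Cantor → A} → LocallyConstant f → ∀ {x y} → x ≗ y → f x ≡ f y
lc-cong f-lc {x} x≗y = proj₂ (radius f-lc x) (λ i _ → x≗y i)

fibre : ∀ {A : Set} {f : Cantor → A} → LocallyConstant f → Pred A 0ℓ → Clopen
fibre {f = f} f-lc S = record
  { set      = f ⊢ S
  ; isOpen   = λ {x} → open′ S {x}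
  ; isClosed = λ {x} → open′ (∁ S) {x}
  }
  where
  open′ : ∀ S → IsOpen (f ⊢ S)
  open′ S {x} fx∈S = proj₁ (radius f-lc x) , λ x~y → subst S (proj₂ (radius f-lc x) x~y) fx∈S

fibre-at : ∀ {A : Set} {f : Cantor → A} → LocallyConstant f → A → Clopen
fibre-at f-lc a = fibre f-lc (_≡ a)

-- Uniqueness of limits in an ordered field

module OrderedField (ℝ : CompleteOrderedField) where
  open CompleteOrderedField ℝ hiding (refl; sym; trans; zero)
  private module ≈ = CompleteOrderedField ℝ
  private module ≤ = IsTotalOrder isTotalOrder
  open import Algebra.Properties.AbelianGroup +-abelianGroup using ()
    renaming (∙-cancelˡ to +-cancelˡ) public
  open import Relation.Binary.Reasoning.Setoid setoid

  +-mono-≤ : ∀ {x y z w} → x ≤ y → z ≤ w → x + z ≤ y + w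
  +-mono-≤ {x} {y} {z} {w} x≤y z≤w = ≤.trans (+-monoˡ-≤ z x≤y)
    (≤.trans (≤.reflexive (+-comm y z)) (≤.trans (+-monoˡ-≤ y z≤w) (≤.reflexive (+-comm w y))))

  x≤x+y : ∀ {x y} → 0# ≤ y → x ≤ x + y
  x≤x+y {x} 0≤y = ≤.trans (≤.reflexive (≈.sym (+-identityʳ x))) (+-mono-≤ ≤.refl 0≤y)

  0≤1 : 0# ≤ 1#
  0≤1 with ≤.total 0# 1#
  ... | inj₁ 0≤1 = 0≤1
  ... | inj₂ 1≤0 = ≤.trans (*-nonNeg 0≤-1 0≤-1) (≤.reflexive -1*-1≈1)
    where
    open import Algebra.Properties.Ring ring using (-1*x≈-x; -‿involutive)

    0≤-1 : 0# ≤ - 1#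
    0≤-1 = ≤.trans (≤.reflexive (≈.sym (-‿inverseʳ 1#)))
      (≤.trans (+-monoˡ-≤ (- 1#) 1≤0) (≤.reflexive (+-identityˡ (- 1#))))

    -1*-1≈1 : - 1# * - 1# ≈ 1#
    -1*-1≈1 = ≈.trans (-1*x≈-x (- 1#)) (-‿involutive 1#)

  half : ∃[ h ] (0# ≤ h × h + h ≈ 1#)
  half = h , 0≤h , h+h≈1
    where
    2≉0 : ¬ (1# + 1# ≈ 0#)
    2≉0 2≈0 = 0≉1 (≤.antisym 0≤1 (≤.trans (x≤x+y 0≤1) (≤.reflexive 2≈0)))

    h : Carrier
    h = proj₁ (inverse (1# + 1#) 2≉0)

    h+h≈1 : h + h ≈ 1#
    h+h≈1 = begin
      h + h             ≈⟨ +-cong (*-identityˡ h) (*-identityˡ h) ⟨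
      1# * h + 1# * h   ≈⟨ distribʳ h 1# 1# ⟨
      (1# + 1#) * h     ≈⟨ proj₂ (inverse (1# + 1#) 2≉0) ⟩
      1#                ∎

    0≤h : 0# ≤ h
    0≤h with ≤.total 0# h
    ... | inj₁ 0≤h = 0≤h
    ... | inj₂ h≤0 = contradiction
      (≤.antisym 0≤1 (≤.trans (≤.reflexive (≈.sym h+h≈1))
        (≤.trans (+-mono-≤ h≤0 h≤0) (≤.reflexive (+-identityˡ 0#))))) 0≉1

  -- `ε` is half the distance, so the open intervals of radius `ε` around `l` and `l′` share only an
  -- endpoint, which belongs to neither.
  midpoint : ∀ {l l′} → l < l′ → ∃[ ε ] (0# < ε × l + ε ≈ l′ + - ε)
  midpoint {l} {l′} (l≤l′ , l≉l′) =
    ε , (*-nonNeg 0≤h 0≤d , λ 0≈ε → l≉l′ (l≈l′ 0≈ε)) , l+ε≈l′-ε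
    where
    h   = proj₁ half
    0≤h = proj₁ (proj₂ half)
    d   = l′ + - l
    ε   = h * d

    0≤d : 0# ≤ d
    0≤d = ≤.trans (≤.reflexive (≈.sym (-‿inverseʳ l))) (+-monoˡ-≤ (- l) l≤l′)

    l+ε+ε≈l′ : (l + ε) + ε ≈ l′
    l+ε+ε≈l′ = begin
      (l + ε) + ε       ≈⟨ +-assoc l ε ε ⟩
      l + (ε + ε)       ≈⟨ +-congˡ (distribʳ d h h) ⟨
      l + (h + h) * d   ≈⟨ +-congˡ (*-congʳ (proj₂ (proj₂ half))) ⟩
      l + 1# * d        ≈⟨ +-congˡ (*-identityˡ d) ⟩
      l + (l′ + - l)    ≈⟨ +-comm l (l′ + - l) ⟩
      (l′ + - l) + l    ≈⟨ +-assoc l′ (- l) l ⟩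
      l′ + (- l + l)    ≈⟨ +-congˡ (-‿inverseˡ l) ⟩
      l′ + 0#           ≈⟨ +-identityʳ l′ ⟩
      l′                ∎

    l+ε≈l′-ε : l + ε ≈ l′ + - ε
    l+ε≈l′-ε = begin
      l + ε                 ≈⟨ +-identityʳ (l + ε) ⟨
      (l + ε) + 0#          ≈⟨ +-congˡ (-‿inverseʳ ε) ⟨
      (l + ε) + (ε + - ε)   ≈⟨ +-assoc (l + ε) ε (- ε) ⟨
      ((l + ε) + ε) + - ε   ≈⟨ +-congʳ l+ε+ε≈l′ ⟩
      l′ + - ε              ∎

    l≈l′ : 0# ≈ ε → l ≈ l′
    l≈l′ 0≈ε = begin
      l               ≈⟨ +-identityʳ l ⟨
      l + 0#          ≈⟨ +-identityʳ (l + 0#) ⟨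
      (l + 0#) + 0#   ≈⟨ +-cong (+-congˡ 0≈ε) 0≈ε ⟩
      (l + ε) + ε     ≈⟨ l+ε+ε≈l′ ⟩
      l′              ∎

  limits-≮ : ∀ {a b l l′} → ConvergesTo a l → ConvergesTo b l′ →
             ∃[ N ] (∀ n → N ℕ.≤ n → a n ≈ b n) → ¬ (l < l′)
  limits-≮ {a} {b} a→l b→l′ (N , a≈b) l<l′
    with ε , 0<ε , mid ← midpoint l<l′
    with M , a~l ← a→l ε 0<ε
    with M′ , b~l′ ← b→l′ ε 0<ε
    = aₙ≉ (≤.antisym aₙ≤ (≤.trans (≤.reflexive mid)
        (≤.trans (proj₁ (proj₁ (b~l′ n M′≤n))) (≤.reflexive (≈.sym (a≈b n N≤n))))))
    where
    n    = N ⊔ (M ⊔ M′)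
    N≤n  = ℕ.m≤m⊔n N (M ⊔ M′)
    M≤n  = ℕ.≤-trans (ℕ.m≤m⊔n M M′) (ℕ.m≤n⊔m N (M ⊔ M′))
    M′≤n = ℕ.≤-trans (ℕ.m≤n⊔m M M′) (ℕ.m≤n⊔m N (M ⊔ M′))
    aₙ≤  = proj₁ (proj₂ (a~l n M≤n))
    aₙ≉  = proj₂ (proj₂ (a~l n M≤n))

  limit-unique : (∀ x y → Dec (x ≈ y)) → ∀ {a b l l′} → ConvergesTo a l → ConvergesTo b l′ →
                 ∃[ N ] (∀ n → N ℕ.≤ n → a n ≈ b n) → l ≈ l′
  limit-unique _≈?_ {l = l} {l′} a→l b→l′ (N , a≈b) = decidable-stable (l ≈? l′) λ l≉l′ →
    [ (λ l≤l′ → limits-≮ a→l b→l′ (N , a≈b) (l≤l′ , l≉l′))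
    , (λ l′≤l → limits-≮ b→l′ a→l (N , λ n N≤n → ≈.sym (a≈b n N≤n)) (l′≤l , l≉l′ ∘ ≈.sym))
    ]′ (≤.total l l′)

  constant-converges : ∀ c → ConvergesTo (λ _ → c) c
  constant-converges c ε (0≤ε , 0≉ε) = 0 , λ _ _ → (c-ε≤c , c-ε≉c) , (x≤x+y 0≤ε , c≉c+ε)
    where
    c≈c-ε+ε : c ≈ (c + - ε) + ε
    c≈c-ε+ε = begin
      c               ≈⟨ +-identityʳ c ⟨
      c + 0#          ≈⟨ +-congˡ (-‿inverseˡ ε) ⟨
      c + (- ε + ε)   ≈⟨ +-assoc c (- ε) ε ⟨
      (c + - ε) + ε   ∎

    c≉c+ε : ¬ (c ≈ c + ε)
    c≉c+ε eq = 0≉ε (+-cancelˡ c 0# ε (≈.trans (+-identityʳ c) eq))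

    c-ε≤c : c + - ε ≤ c
    c-ε≤c = ≤.trans (x≤x+y 0≤ε) (≤.reflexive (≈.sym c≈c-ε+ε))

    c-ε≉c : ¬ (c + - ε ≈ c)
    c-ε≉c eq = 0≉ε (+-cancelˡ c 0# ε (begin
      c + 0#          ≈⟨ +-identityʳ c ⟩
      c               ≈⟨ c≈c-ε+ε ⟩
      (c + - ε) + ε   ≈⟨ +-congʳ eq ⟩
      c + ε           ∎))

-- Clopen sets and compactness of the Cantor space

module Classical (em : ExcludedMiddle (lsuc 0ℓ)) where

  abstract
    decide : (A : Set) → Dec A
    decide A = map′ lower lift em

  infixr 7 _⊓_
  infix 8 _ᶜ

  _ᶜ : Clopen → Clopen
  C ᶜ = record
    { set      = ∁ (set C)
    ; isOpen   = Clopen.isClosed C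
    ; isClosed = λ {x} ¬x∉C →
        let n , ⊆C = Clopen.isOpen C (decidable-stable (decide (x ∈ set C)) ¬x∉C)
        in n , λ x~y y∉C → y∉C (⊆C x~y)
    }

  _⊓_ : Clopen → Clopen → Clopen
  C ⊓ D = record
    { set      = set C ∩ set D
    ; isOpen   = λ (x∈C , x∈D) →
        let m , ⊆C = Clopen.isOpen C x∈C
            n , ⊆D = Clopen.isOpen D x∈D
        in m ⊔ n , λ x~y → ⊆C (cylinder-mono (ℕ.m≤m⊔n m n) x~y) , ⊆D (cylinder-mono (ℕ.m≤n⊔m m n) x~y)
    ; isClosed = closed
    }
    where
    closed : IsOpen (∁ (set C ∩ set D))
    closed {x} x∉C∩D with decide (x ∈ set C)
    ... | yes x∈C = let n , ⊆Dᶜ = Clopen.isClosed D (λ x∈D → x∉C∩D (x∈C , x∈D))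
                    in n , λ x~y (_ , y∈D) → ⊆Dᶜ x~y y∈D
    ... | no x∉C  = let n , ⊆Cᶜ = Clopen.isClosed C x∉C
                    in n , λ x~y (y∈C , _) → ⊆Cᶜ x~y y∈C

  preimageᶜ : ∀ {f} → IsContinuous f → Clopen → Clopen
  preimageᶜ {f} cont C = record
    { set      = f ⊢ set C
    ; isOpen   = λ {x} → cont (Clopen.isOpen C) {x}
    ; isClosed = λ {x} → cont (Clopen.isClosed C) {x}
    }

  indicator : Clopen → Cantor → Bool
  indicator C x = does (decide (x ∈ set C))

  indicator-true : ∀ C {x} → x ∈ set C → indicator C x ≡ true
  indicator-true C {x} = dec-true (decide (x ∈ set C))

  indicator-true⁻¹ : ∀ C {x} → indicator C x ≡ true → x ∈ set C
  indicator-true⁻¹ C {x} eq with decide (x ∈ set C)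
  ... | yes x∈C = x∈C
  ... | no x∉C with () ← eq

  indicator-lc : ∀ C → LocallyConstant (indicator C)
  indicator-lc C = locally r
    where
    r : ∀ x → ∃[ n ] (∀ {y} → cylinder x n y → indicator C x ≡ indicator C y)
    r x with decide (x ∈ set C)
    ... | yes x∈C = let n , ⊆C = Clopen.isOpen C x∈C
                    in n , λ x~y → sym (indicator-true C (⊆C x~y))
    ... | no x∉C  = let n , ⊆Cᶜ = Clopen.isClosed C x∉C
                    in n , λ {y} x~y → sym (dec-false (decide (y ∈ set C)) (⊆Cᶜ x~y))

  least : ∀ (P : ℕ → Set) n → P n → ∃[ m ] (P m × ∀ i → i ℕ.< m → ¬ P i)
  least P n = below n n ℕ.≤-refl
    where
    below : ∀ k n → n ℕ.≤ k → P n → ∃[ m ] (P m × ∀ i → i ℕ.< m → ¬ P i)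
    below k n n≤k Pn with decide (∃[ i ] (i ℕ.< n × P i))
    ... | no none                = n , Pn , λ i i<n Pi → none (i , i<n , Pi)
    below zero    _ ℕ.z≤n Pn | yes (_ , () , _)
    below (suc k) n n≤1+k Pn | yes (i , i<n , Pi) =
      below k i (ℕ.s≤s⁻¹ (ℕ.≤-trans i<n n≤1+k)) Pi

  -- If G failed at the root, following failures would trace out a point contradicting its barring.
  fan : (G : ∀ n → Fin (2 ^ n) → Set) →
        (∀ n p → (∀ b → G (suc n) (combine (bit b) p)) → G n p) →
        (∀ x → ∃[ n ] G n (prefix n x)) → G zero zero
  fan G glue bar with decide (G zero zero)
  ... | yes g = g
  ... | no ¬g = contradiction (proj₂ (bar x)) λ g → proj₂ (path n) (subst (G n) (sym (path-prefix n)) g)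
    where
    bad-child : ∀ n p → ¬ G n p → ∃[ b ] ¬ G (suc n) (combine (bit b) p)
    bad-child n p ¬g with decide (∃[ b ] ¬ G (suc n) (combine (bit b) p))
    ... | yes bad = bad
    ... | no none = contradiction
      (glue n p λ b → decidable-stable (decide _) λ ¬gb → none (b , ¬gb)) ¬g

    path : ∀ n → ∃[ p ] ¬ G n p
    path zero    = zero , ¬g
    path (suc n) = let b , ¬gb = bad-child n _ (proj₂ (path n)) in _ , ¬gb

    x : Cantor
    x n = proj₁ (bad-child n _ (proj₂ (path n)))

    n : ℕ
    n = proj₁ (bar x)

    path-prefix : ∀ n → proj₁ (path n) ≡ prefix n x
    path-prefix zero    = refl
    path-prefix (suc n) = cong (combine (bit (x n))) (path-prefix n)

  -- By `fan`: a uniform radius on both children of a node gives their maximum on the node, and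
  -- local constancy at `x` provides one on a small cylinder around `x`.
  uniform : ∀ {A : Set} {f : Cantor → A} → LocallyConstant f →
            ∃[ N ] (∀ {x y} → cylinder x N y → f x ≡ f y)
  uniform {f = f} f-lc = let N , const = fan G glue bar in N , λ x~y → const refl x~y
    where
    G : ∀ n → Fin (2 ^ n) → Set
    G n p = ∃[ N ] (∀ {x y} → prefix n x ≡ p → cylinder x N y → f x ≡ f y)

    glue : ∀ n p → (∀ b → G (suc n) (combine (bit b) p)) → G n p
    glue n p g = N false ⊔ N true , λ {x} x∈p x~y →
      proj₂ (g (x n)) (cong (combine (bit (x n))) x∈p) (cylinder-mono (N≤ (x n)) x~y)
      where
      N : Bool → ℕ
      N b = proj₁ (g b)

      N≤ : ∀ b → N b ℕ.≤ N false ⊔ N true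
      N≤ false = ℕ.m≤m⊔n _ _
      N≤ true  = ℕ.m≤n⊔m (N false) _

    bar : ∀ x → ∃[ n ] G n (prefix n x)
    bar x =
      let n , const = radius f-lc x
      in n , n , λ z∈x z~y →
        let x~z = prefix⇒cylinder n (sym z∈x)
        in trans (sym (const x~z)) (const (cylinder-trans x~z z~y))

  closed⇒compact : ∀ {K} → IsOpen (∁ K) → IsCompact K
  closed⇒compact {K} Kᶜ-open I O O-open K⊆⋃O =
    let is , covers = fan G glue bar in is , λ x∈K → covers refl x∈K
    where
    G : ∀ n → Fin (2 ^ n) → Set
    G n p = ∃[ is ] (∀ {x} → prefix n x ≡ p → x ∈ K → Any (λ i → x ∈ O i) is)

    glue : ∀ n p → (∀ b → G (suc n) (combine (bit b) p)) → G n p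
    glue n p g = proj₁ (g false) ++ proj₁ (g true) , λ {x} x∈p x∈K →
      weaken (x n) (proj₂ (g (x n)) (cong (combine (bit (x n))) x∈p) x∈K)
      where
      weaken : ∀ b {x} → Any (λ i → x ∈ O i) (proj₁ (g b)) →
               Any (λ i → x ∈ O i) (proj₁ (g false) ++ proj₁ (g true))
      weaken false = Any.++⁺ˡ
      weaken true  = Any.++⁺ʳ (proj₁ (g false))

    bar : ∀ x → ∃[ n ] G n (prefix n x)
    bar x with decide (x ∈ K)
    ... | yes x∈K =
      let i , x∈Oi = K⊆⋃O x∈K
          n , ⊆Oi  = O-open i x∈Oi
      in n , (i ∷ []) , λ y∈x _ → here (⊆Oi (prefix⇒cylinder n (sym y∈x)))
    -- Off `K` a small cylinder misses `K`, so the empty list covers it vacuously.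
    ... | no x∉K =
      let n , ⊆Kᶜ = Kᶜ-open x∉K
      in n , [] , λ y∈x y∈K → contradiction y∈K (⊆Kᶜ (prefix⇒cylinder n (sym y∈x)))

-- Dynkin's π-λ theorem

-- The generating π-system. The depth `n` tells at which finite stage of a construction a set can be
-- tested.
Determined : ℕ → Pred Cantor 0ℓ → Set
Determined n D = ∀ {x y} → cylinder x n y → x ∈ D → y ∈ D

∁-determined : ∀ {n D} → Determined n D → Determined n (∁ D)
∁-determined {n} det x~y x∉D y∈D = x∉D (det {_} (cylinder-sym {n = n} x~y) y∈D)

determined : ∀ {n D} → Determined n D → Clopen
determined {n} {D} det = record
  { set      = D
  ; isOpen   = λ x∈D → n , λ x~y → det x~y x∈D
  ; isClosed = λ x∉D → n , λ x~y → ∁-determined {n} {D} det x~y x∉D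
  }

-- The λ-system is inductive so that invariance can be proved by recursion on it. Recursion on
-- `IsBorel` would fail at unions, where additivity requires disjointness.
data Dynkin : Pred Cantor 0ℓ → Set₁ where
  determined-set : ∀ {n D} → Determined n D → Dynkin D
  complement     : ∀ {B} → Dynkin B → Dynkin (∁ B)
  disjoint-union : ∀ {B : ℕ → Pred Cantor 0ℓ} → (∀ n → Dynkin (B n)) →
                   (∀ m n → m ≢ n → B m ⊥ B n) → Dynkin (⋃ ℕ B)
  resp           : ∀ {B C} → B ≐ C → Dynkin B → Dynkin C

dynkin⇒borel : ∀ {B} → Dynkin B → IsBorel B
dynkin⇒borel (determined-set det)   = open-set (Clopen.isOpen (determined det))
dynkin⇒borel (complement b)         = complement (dynkin⇒borel b)
dynkin⇒borel (disjoint-union b _)   = union (λ n → dynkin⇒borel (b n))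
dynkin⇒borel (resp B≐C b)           = resp B≐C (dynkin⇒borel b)

module _ (em : ExcludedMiddle (lsuc 0ℓ)) where
  open Classical em

  dynkin-∪ : ∀ {B C} → Dynkin B → Dynkin C → B ⊥ C → Dynkin (B ∪ C)
  dynkin-∪ {B} {C} b c B⊥C = resp
    ( (λ { (0 , x∈B) → inj₁ x∈B ; (1 , x∈C) → inj₂ x∈C ; (suc (suc _) , ()) })
    , λ { (inj₁ x∈B) → 0 , x∈B ; (inj₂ x∈C) → 1 , x∈C })
    (disjoint-union f disj)
    where
    F : ℕ → Pred Cantor 0ℓ
    F 0 = B
    F 1 = C
    F _ = ∅

    f : ∀ n → Dynkin (F n)
    f 0             = b
    f 1             = c
    f (suc (suc _)) = determined-set {0} λ _ ()

    disj : ∀ i j → i ≢ j → F i ⊥ F j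
    disj 0 0 i≢j _           = i≢j refl
    disj 0 1 _ x∈            = B⊥C x∈
    disj 1 0 _ (x∈C , x∈B)   = B⊥C (x∈B , x∈C)
    disj 1 1 i≢j _           = i≢j refl
    disj 0 (suc (suc _)) _ (_ , ())
    disj 1 (suc (suc _)) _ (_ , ())
    disj (suc (suc _)) _ _ (() , _)

  -- A ∩ ∁ B is the complement of the disjoint union of ∁ A and A ∩ B.
  dynkin-∖ : ∀ {A B} → Dynkin A → Dynkin (A ∩ B) → Dynkin (A ∩ ∁ B)
  dynkin-∖ {A} {B} a ab = resp
    ( (λ {x} x∉ → decidable-stable (decide (x ∈ A)) (x∉ ∘ inj₁) , λ x∈B →
        x∉ (inj₁ λ x∈A → x∉ (inj₂ (x∈A , x∈B))))
    , λ { (x∈A , x∉B) (inj₁ x∉A) → x∉A x∈A ; (x∈A , x∉B) (inj₂ (_ , x∈B)) → x∉B x∈B })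
    (complement (dynkin-∪ (complement a) ab λ (x∉A , x∈A , _) → x∉A x∈A))

  -- For fixed `A` the sets whose intersection with `A` is Dynkin form a λ-system, so the generators
  -- suffice. `dynkin-∩` uses this twice: with `A` determined, then with `A` arbitrary.
  dynkin-∩-extend : ∀ {A} → Dynkin A → (∀ {n D} → Determined n D → Dynkin (A ∩ D)) →
                    ∀ {B} → Dynkin B → Dynkin (A ∩ B)
  dynkin-∩-extend a base (determined-set det) = base det
  dynkin-∩-extend a base (complement b)       = dynkin-∖ a (dynkin-∩-extend a base b)
  dynkin-∩-extend a base (disjoint-union b disj) = resp
    ((λ (n , x∈A , x∈B) → x∈A , n , x∈B) , λ (x∈A , n , x∈B) → n , x∈A , x∈B)
    (disjoint-union (λ n → dynkin-∩-extend a base (b n))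
      λ m n m≢n ((_ , x∈Bm) , (_ , x∈Bn)) → disj m n m≢n (x∈Bm , x∈Bn))
  dynkin-∩-extend a base (resp (B⊆C , C⊆B) b) = resp
    ((λ (x∈A , x∈B) → x∈A , B⊆C x∈B) , λ (x∈A , x∈C) → x∈A , C⊆B x∈C)
    (dynkin-∩-extend a base b)

  dynkin-∩ : ∀ {A B} → Dynkin A → Dynkin B → Dynkin (A ∩ B)
  dynkin-∩ a b = dynkin-∩-extend a
    (λ det → resp ((λ (x∈D , x∈A) → x∈A , x∈D) , λ (x∈A , x∈D) → x∈D , x∈A)
      (dynkin-∩-extend (determined-set det) (determined-∩ det) a)) b
    where
    determined-∩ : ∀ {m n C D} → Determined m C → Determined n D → Dynkin (C ∩ D)
    determined-∩ {m} {n} c d = determined-set {m ⊔ n} λ x~y (x∈C , x∈D) →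
      c (cylinder-mono (ℕ.m≤m⊔n m n) x~y) x∈C , d (cylinder-mono (ℕ.m≤n⊔m m n) x~y) x∈D

  least-disjoint : ∀ (P : ℕ → Pred Cantor 0ℓ) →
    ∀ m n → m ≢ n → (λ x → P m x × ∀ i → i ℕ.< m → x ∉ P i) ⊥ (λ x → P n x × ∀ i → i ℕ.< n → x ∉ P i)
  least-disjoint P m n m≢n ((x∈Pm , min) , (x∈Pn , min′)) with ℕ.<-cmp m n
  ... | tri< m<n _ _ = min′ m m<n x∈Pm
  ... | tri≈ _ m≡n _ = m≢n m≡n
  ... | tri> _ _ n<m = min n n<m x∈Pn

  -- An open set is the disjoint union over n of its points having n as least radius.
  open⇒dynkin : ∀ {O} → IsOpen O → Dynkin O
  open⇒dynkin {O} O-open = resp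
    ( (λ (_ , ⊆O , _) → ⊆O λ _ _ → refl)
    , λ {x} x∈O → least (λ n → P n x) _ (proj₂ (O-open x∈O)))
    (disjoint-union
      (λ n → determined-set {n} λ {x} {y} x~y (⊆O , min) →
        shift n ℕ.≤-refl x~y ⊆O , λ i i<n ⊆O′ → min i i<n (shift i (ℕ.<⇒≤ i<n) (cylinder-sym x~y) ⊆O′))
      (least-disjoint P))
    where
    P : ℕ → Pred Cantor 0ℓ
    P n x = cylinder x n ⊆ O

    shift : ∀ {n x y} i → i ℕ.≤ n → cylinder x n y → cylinder x i ⊆ O → cylinder y i ⊆ O
    shift i i≤n x~y ⊆O y~z = ⊆O (cylinder-trans (cylinder-mono i≤n x~y) y~z)

  -- Each point is assigned to the least index whose set contains it. The resulting disjoint sets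
  -- are Dynkin because of closure under intersection.
  dynkin-⋃ : ∀ {B : ℕ → Pred Cantor 0ℓ} → (∀ n → Dynkin (B n)) → Dynkin (⋃ ℕ B)
  dynkin-⋃ {B} b = resp
    ( (λ (n , x∈B , _) → n , x∈B)
    , λ {x} (n , x∈B) → least (λ n → B n x) n x∈B)
    (disjoint-union (λ n → dynkin-∩ (b n) (avoiding n)) (least-disjoint B))
    where
    avoiding : ∀ n → Dynkin (λ x → ∀ i → i ℕ.< n → x ∉ B i)
    avoiding zero    = determined-set {0} λ _ _ _ ()
    avoiding (suc n) = resp
      ( (λ { (avoid , x∉Bn) i i<1+n → [ avoid i , (λ { refl → x∉Bn }) ]′ (ℕ.m<1+n⇒m<n∨m≡n i<1+n) })
      , λ avoid → (λ i i<n → avoid i (ℕ.m<n⇒m<1+n i<n)) , avoid n ℕ.≤-refl)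
      (dynkin-∩ (avoiding n) (complement (b n)))

  borel⇒dynkin : ∀ {B} → IsBorel B → Dynkin B
  borel⇒dynkin (open-set o)    = open⇒dynkin o
  borel⇒dynkin (complement b)  = complement (borel⇒dynkin b)
  borel⇒dynkin (union b)       = dynkin-⋃ (λ n → borel⇒dynkin (b n))
  borel⇒dynkin (resp B≐C b)    = resp B≐C (borel⇒dynkin b)

-- Finite additivity and invariance on Borel sets

module Measure
  (em : ExcludedMiddle (lsuc 0ℓ)) (ℝ : CompleteOrderedField) (μ : ProbabilityMeasure ℝ) where

  open Classical em
  open OrderedField ℝ
  open CompleteOrderedField ℝ hiding (refl; sym; trans; zero; isEquivalence)
  open ProbabilityMeasure μ renaming (measureᶜ to m; cong to measure-cong)
  private module ≈ = CompleteOrderedField ℝ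
  private module ≤ = IsTotalOrder isTotalOrder
  open import Algebra.Properties.CommutativeMonoid.Sum +-commutativeMonoid using (sum-cong-≋)
  open import Relation.Binary.Reasoning.Setoid setoid

  -- Padding with empty sets makes the partial sums constant from index 2 on, so σ-additivity and
  -- uniqueness of limits give the finite sum.
  measure-∪ : ∀ {B C D} (b : IsBorel B) (c : IsBorel C) (d : IsBorel D) →
              B ⊥ C → D ≐ B ∪ C → measure d ≈ measure b + measure c
  measure-∪ {B} {C} {D} b c d B⊥C (D⊆ , ⊆D) =
    ≈.trans (measure-cong d (union f) ((λ x∈D → ∪⊆⋃ (D⊆ x∈D)) , λ (n , x∈) → ⋃⊆D n x∈))
      (limit-unique (λ x y → decide (x ≈ y)) (σ-additive f F-disjoint)
        (constant-converges (measure b + measure c))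
        (2 , λ { (suc (suc k)) _ → sums k ; (suc zero) (ℕ.s≤s ()) }))
    where
    F : ℕ → Pred Cantor 0ℓ
    F 0 = B
    F 1 = C
    F _ = ∅

    f : ∀ n → IsBorel (F n)
    f 0             = b
    f 1             = c
    f (suc (suc _)) = open-set λ ()

    F-disjoint : ∀ i j → i ≢ j → F i ⊥ F j
    F-disjoint 0 0 i≢j _             = i≢j refl
    F-disjoint 0 1 _ x∈              = B⊥C x∈
    F-disjoint 1 0 _ (x∈C , x∈B)     = B⊥C (x∈B , x∈C)
    F-disjoint 1 1 i≢j _             = i≢j refl
    F-disjoint 0 (suc (suc _)) _ (_ , ())
    F-disjoint 1 (suc (suc _)) _ (_ , ())
    F-disjoint (suc (suc _)) _ _ (() , _)

    ∪⊆⋃ : B ∪ C ⊆ ⋃ ℕ F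
    ∪⊆⋃ (inj₁ x∈B) = 0 , x∈B
    ∪⊆⋃ (inj₂ x∈C) = 1 , x∈C

    ⋃⊆D : ∀ n {x} → x ∈ F n → x ∈ D
    ⋃⊆D 0 x∈B = ⊆D (inj₁ x∈B)
    ⋃⊆D 1 x∈C = ⊆D (inj₂ x∈C)

    sums : ∀ k → ∑< (suc (suc k)) (measure ∘ f) ≈ measure b + measure c
    sums zero    = +-congʳ (+-identityˡ (measure b))
    sums (suc k) = ≈.trans (+-cong (sums k) (empty (open-set λ ()))) (+-identityʳ _)

  m-cong : ∀ {C D} → set C ≐ set D → m C ≈ m D
  m-cong = measure-cong _ _

  m-empty : ∀ C → set C ⊆ ∅ → m C ≈ 0#
  m-empty C C⊆∅ = ≈.trans (measure-cong _ (open-set λ ()) (C⊆∅ , λ ())) (empty (open-set λ ()))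

  m-split : ∀ C D → m C ≈ m (C ⊓ D) + m (C ⊓ D ᶜ)
  m-split C D = measure-∪ _ _ _ (λ ((_ , x∈D) , (_ , x∉D)) → x∉D x∈D)
    ((λ {x} x∈C → split x∈C (decide (x ∈ set D))) , λ { (inj₁ (x∈C , _)) → x∈C ; (inj₂ (x∈C , _)) → x∈C })
    where
    split : ∀ {x} → x ∈ set C → Dec (x ∈ set D) → x ∈ set (C ⊓ D) ∪ set (C ⊓ D ᶜ)
    split x∈C (yes x∈D) = inj₁ (x∈C , x∈D)
    split x∈C (no x∉D)  = inj₂ (x∈C , x∉D)

  m-mono : ∀ {C D} → set C ⊆ set D → m C ≤ m D
  m-mono {C} {D} C⊆D = ≤.trans
    (≤.reflexive (m-cong {C} {D ⊓ C} ((λ x∈C → C⊆D x∈C , x∈C) , proj₂)))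
    (≤.trans (x≤x+y (nonNeg _)) (≤.reflexive (≈.sym (m-split D C))))

  m-nonempty : ∀ C → ¬ (m C ≈ 0#) → ∃[ x ] x ∈ set C
  m-nonempty C m≉0 with decide (∃[ x ] x ∈ set C)
  ... | yes x∈C  = x∈C
  ... | no empty = contradiction (m-empty C λ x∈C → empty (_ , x∈C)) m≉0

  m-⋃ : ∀ {n} (X : Fin n → Clopen) C → (∀ p q → p ≢ q → set (X p) ⊥ set (X q)) →
        set C ≐ ⋃ (Fin n) (λ p → set (X p)) → m C ≈ sum (λ p → m (X p))
  m-⋃ {zero}  X C disj (C⊆ , _)  = m-empty C λ x∈C → contradiction (proj₁ (C⊆ x∈C)) λ ()
  m-⋃ {suc n} X C disj (C⊆ , ⊆C) = ≈.trans (m-split C (X zero)) (+-cong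
    (m-cong {C ⊓ X zero} {X zero} (proj₂ , λ x∈X → ⊆C (zero , x∈X) , x∈X))
    (m-⋃ (X ∘ suc) (C ⊓ X zero ᶜ) (λ p q p≢q → disj (suc p) (suc q) (p≢q ∘ Fin.suc-injective))
      ( (λ (x∈C , x∉X₀) → drop (C⊆ x∈C) x∉X₀)
      , λ (p , x∈X) → ⊆C (suc p , x∈X) , λ x∈X₀ → disj zero (suc p) (λ ()) (x∈X₀ , x∈X))))
    where
    drop : ∀ {x} → x ∈ ⋃ (Fin (suc n)) (λ p → set (X p)) → x ∉ set (X zero) →
           x ∈ ⋃ (Fin n) (λ p → set (X (suc p)))
    drop (zero  , x∈X) x∉X₀ = contradiction x∈X x∉X₀
    drop (suc p , x∈X) _    = p , x∈X

  m-sum : ∀ {n} {f : Cantor → Fin n} (f-lc : LocallyConstant f) C →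
          m C ≈ sum (λ p → m (C ⊓ fibre-at f-lc p))
  m-sum {f = f} f-lc C = m-⋃ (λ p → C ⊓ fibre-at f-lc p) C
    (λ p q p≢q ((_ , fx≡p) , (_ , fx≡q)) → p≢q (trans (sym fx≡p) fx≡q))
    ((λ {x} x∈C → f x , x∈C , refl) , λ (_ , x∈C , _) → x∈C)

  -- The factor `C` lets one statement serve for the pieces, with `C` the whole space, and for each
  -- of the two indices of a cell.
  m-sum-fibre : ∀ {n k} {r : Cantor → Fin n} (r-lc : LocallyConstant r) (f : Fin n → Fin k) p C →
    m (fibre-at (∘-lc f r-lc) p ⊓ C) ≈ ∑-fibre f p (λ q → m (fibre-at r-lc q ⊓ C))
  m-sum-fibre {r = r} r-lc f p C = ≈.trans (m-sum r-lc F) (sum-cong-≋ term)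
    where
    F = fibre-at (∘-lc f r-lc) p ⊓ C

    term : ∀ q → m (F ⊓ fibre-at r-lc q) ≈
                 (if does (f q Fin.≟ p) then m (fibre-at r-lc q ⊓ C) else 0#)
    term q with f q Fin.≟ p
    ... | yes fq≡p = m-cong {F ⊓ fibre-at r-lc q} {fibre-at r-lc q ⊓ C}
      ( (λ ((_ , x∈C) , rx≡q) → rx≡q , x∈C)
      , λ (rx≡q , x∈C) → (trans (cong f rx≡q) fq≡p , x∈C) , rx≡q)
    ... | no fq≢p  = m-empty (F ⊓ fibre-at r-lc q)
      λ ((frx≡p , _) , rx≡q) → fq≢p (trans (cong f (sym rx≡q)) frx≡p)

  measure-∁ : ∀ {B} (b : IsBorel B) (c : IsBorel (∁ B)) → measure b + measure c ≈ 1#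
  measure-∁ {B} b c = ≈.trans
    (≈.sym (measure-∪ b c (open-set λ _ → 0 , _) (λ (x∈B , x∉B) → x∉B x∈B)
      ((λ {x} _ → cases (decide (x ∈ B))) , _)))
    (total (open-set λ _ → 0 , _))
    where
    cases : ∀ {x} → Dec (x ∈ B) → x ∈ B ∪ ∁ B
    cases (yes x∈B) = inj₁ x∈B
    cases (no x∉B)  = inj₂ x∉B

  -- Measures depend on a proof of being Borel, and the proofs arising in the recursion differ from
  -- the given ones; hence the statement for arbitrary `b` and `c`.
  preserves-dynkin : ∀ {f} → IsContinuous f →
    (∀ {n D} (det : Determined n D) (b : IsBorel (f ⊢ D)) → measure b ≈ m (determined det)) →
    ∀ {B} → Dynkin B → (b : IsBorel (f ⊢ B)) (c : IsBorel B) → measure b ≈ measure c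
  preserves-dynkin cont base (determined-set det) b c = ≈.trans (base det b) (measure-cong _ c (id , id))
  preserves-dynkin cont base (complement d) b c = +-cancelˡ (measure b₀) _ _ (begin
    measure b₀ + measure b   ≈⟨ measure-∁ b₀ b ⟩
    1#                       ≈⟨ measure-∁ c₀ c ⟨
    measure c₀ + measure c   ≈⟨ +-congʳ (preserves-dynkin cont base d b₀ c₀) ⟨
    measure b₀ + measure c   ∎)
    where
    c₀ = dynkin⇒borel d
    b₀ = preimage-borel cont c₀
  preserves-dynkin cont base (disjoint-union d disj) b c =
    ≈.trans (measure-cong b (union b′) (id , id)) (≈.trans
      (limit-unique (λ x y → decide (x ≈ y)) (σ-additive b′ (λ i j i≢j → disj i j i≢j))
        (σ-additive c′ disj) (0 , λ n _ → sums n))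
      (measure-cong (union c′) c (id , id)))
    where
    c′ = λ n → dynkin⇒borel (d n)
    b′ = λ n → preimage-borel cont (c′ n)

    sums : ∀ n → ∑< n (measure ∘ b′) ≈ ∑< n (measure ∘ c′)
    sums zero    = ≈.refl
    sums (suc n) = +-cong (sums n) (preserves-dynkin cont base (d n) (b′ n) (c′ n))
  preserves-dynkin cont base (resp (B⊆C , C⊆B) d) b c = ≈.trans
    (measure-cong b (preimage-borel cont c₀) (C⊆B , B⊆C))
    (≈.trans (preserves-dynkin cont base d _ c₀) (measure-cong c₀ c (B⊆C , C⊆B)))
    where
    c₀ = dynkin⇒borel d

  homeo : (f g : Cantor → Cantor) → Continuous f → Continuous g →
          (∀ x → f (g x) ≗ x) → (∀ x → g (f x) ≗ x) →
          (∀ {n D} (det : Determined n D) (b : IsBorel (f ⊢ D)) → measure b ≈ m (determined det)) →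
          MeasureHomeo μ
  homeo f g f-cont g-cont fg gf base = record
    { to              = f
    ; from            = g
    ; to-continuous   = continuous f-cont
    ; from-continuous = continuous g-cont
    ; to-from         = fg
    ; from-to         = gf
    ; preserves       = λ b →
        preserves-dynkin (continuous f-cont) base (borel⇒dynkin em b) (preimage-borel (continuous f-cont) b) b
    }

-- Matched labellings of a good measure

module GoodMeasure
  (em : ExcludedMiddle (lsuc 0ℓ)) (ℝ : CompleteOrderedField) (μ : ProbabilityMeasure ℝ)
  (good : IsGood μ) where

  open Classical em
  open OrderedField ℝ
  open Measure em ℝ μ
  open CompleteOrderedField ℝ hiding (refl; sym; trans; zero; isEquivalence)
  open ProbabilityMeasure μ renaming (measureᶜ to m; cong to measure-cong)
  open MeasureHomeo
  private module ≈ = CompleteOrderedField ℝ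
  private module ≤ = IsTotalOrder isTotalOrder
  open import Algebra.Properties.CommutativeMonoid.Sum +-commutativeMonoid using (sum-cong-≋)
  open import Relation.Binary.Reasoning.Setoid setoid

  m-inhabited : ∀ C {x} → x ∈ set C → ¬ (m C ≈ 0#)
  m-inhabited C x∈C m≈0 = proj₂ (IsGood.full good (Clopen.isOpen C) (_ , x∈C)) (≈.sym m≈0)

  abstract
    -- Goodness speaks of a strict inequality; if the measures agree, `D` itself serves.
    subclopen : ∀ C D → m C ≤ m D → ∃[ W ] (set W ⊆ set D × m W ≈ m C)
    subclopen C D C≤D with decide (m C ≈ m D)
    ... | yes C≈D = D , id , ≈.sym C≈D
    ... | no C≉D  = IsGood.subset good C D (C≤D , C≉D)

  -- `left` labels the source and `right` the target of the homeomorphism to be built. A label with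
  -- an empty fibre on one side has, by fullness, an empty fibre on the other.
  record Matching (I : Set) : Set where
    field
      left     : Cantor → I
      right    : Cantor → I
      left-lc  : LocallyConstant left
      right-lc : LocallyConstant right
      balanced : ∀ i → m (fibre-at left-lc i) ≈ m (fibre-at right-lc i)

  open Matching

  swap : ∀ {I} → Matching I → Matching I
  swap M = record
    { left     = right M
    ; right    = left M
    ; left-lc  = right-lc M
    ; right-lc = left-lc M
    ; balanced = λ i → ≈.sym (balanced M i)
    }

  module Refine {I : Set} (M : Matching I) {c : Cantor → Bool} (c-lc : LocallyConstant c) where

    L : I → Clopen
    L = fibre-at (left-lc M)

    R : I → Clopen
    R = fibre-at (right-lc M)

    -- The left side is cut by the given `c`, and the right side must be cut to match: goodness
    -- supplies, inside each right fibre, a copy of the half where `c` is true. The other halves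
    -- then match by cancellation.
    part : ∀ i → ∃[ W ] (set W ⊆ set (R i) × m W ≈ m (L i ⊓ fibre-at c-lc true))
    part i = subclopen (L i ⊓ fibre-at c-lc true) (R i)
      (≤.trans (m-mono {L i ⊓ fibre-at c-lc true} {L i} proj₁) (≤.reflexive (balanced M i)))

    W : I → Clopen
    W i = proj₁ (part i)

    c′ : Cantor → Bool
    c′ x = indicator (W (right M x)) x

    c′-lc : LocallyConstant c′
    c′-lc = dependent-lc (right-lc M) (λ i → indicator-lc (W i))

    two : ∀ {d : Cantor → Bool} (d-lc : LocallyConstant d) C →
          m C ≈ m (C ⊓ fibre-at d-lc true) + m (C ⊓ fibre-at d-lc false)
    two d-lc C = ≈.trans (m-split C (fibre-at d-lc true)) (+-congˡ (m-cong
      {C ⊓ fibre-at d-lc true ᶜ} {C ⊓ fibre-at d-lc false}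
      ( (λ (x∈C , dx≢t) → x∈C , ¬-not dx≢t)
      , λ (x∈C , dx≡f) → x∈C , λ dx≡t → contradiction (trans (sym dx≡t) dx≡f) λ ())))

    balanced-true : ∀ i → m (L i ⊓ fibre-at c-lc true) ≈ m (R i ⊓ fibre-at c′-lc true)
    balanced-true i = ≈.trans (≈.sym (proj₂ (proj₂ (part i)))) (m-cong
      {W i} {R i ⊓ fibre-at c′-lc true}
      ( (λ {x} x∈W → proj₁ (proj₂ (part i)) x∈W , to-c′ (proj₁ (proj₂ (part i)) x∈W) x∈W)
      , λ { (refl , c′x≡t) → indicator-true⁻¹ (W i) c′x≡t }))
      where
      to-c′ : ∀ {x} → right M x ≡ i → x ∈ set (W i) → c′ x ≡ true
      to-c′ {x} refl = indicator-true (W (right M x))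

    balanced-false : ∀ i → m (L i ⊓ fibre-at c-lc false) ≈ m (R i ⊓ fibre-at c′-lc false)
    balanced-false i = +-cancelˡ (m (L i ⊓ fibre-at c-lc true)) _ _ (begin
      m (L i ⊓ fibre-at c-lc true) + m (L i ⊓ fibre-at c-lc false)     ≈⟨ two c-lc (L i) ⟨
      m (L i)                                                          ≈⟨ balanced M i ⟩
      m (R i)                                                          ≈⟨ two c′-lc (R i) ⟩
      m (R i ⊓ fibre-at c′-lc true) + m (R i ⊓ fibre-at c′-lc false)   ≈⟨ +-congʳ (balanced-true i) ⟨
      m (L i ⊓ fibre-at c-lc true) + m (R i ⊓ fibre-at c′-lc false)    ∎)

    balanced-pair : ∀ i b → m (L i ⊓ fibre-at c-lc b) ≈ m (R i ⊓ fibre-at c′-lc b)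
    balanced-pair i true  = balanced-true i
    balanced-pair i false = balanced-false i

    refine : Matching (I × Bool)
    refine = record
      { left     = λ x → left M x , c x
      ; right    = λ x → right M x , c′ x
      ; left-lc  = pair-lc (left-lc M) c-lc
      ; right-lc = pair-lc (right-lc M) c′-lc
      ; balanced = λ (i , b) → ≈.trans
          (m-cong {fibre-at (pair-lc (left-lc M) c-lc) (i , b)} {L i ⊓ fibre-at c-lc b}
            (pair≐ (left M) c))
          (≈.trans (balanced-pair i b)
            (m-cong {R i ⊓ fibre-at c′-lc b} {fibre-at (pair-lc (right-lc M) c′-lc) (i , b)}
              (Product.swap (pair≐ (right M) c′))))
      }
      where
      pair≐ : ∀ {A B : Set} (f : Cantor → A) (g : Cantor → B) {a b} →
              (λ x → (f x , g x) ≡ (a , b)) ≐ (λ x → f x ≡ a × g x ≡ b)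
      pair≐ _ _ = (λ { refl → refl , refl }) , λ { (refl , refl) → refl }

  open Refine using (refine)

  -- Stands in for finiteness of the label type. It passes to products, so iterated refinements need
  -- no enumeration of their labels.
  Additive : Set → Set₁
  Additive I = ∀ {f g : Cantor → I} (f-lc : LocallyConstant f) (g-lc : LocallyConstant g) C D →
    (∀ i → m (C ⊓ fibre-at f-lc i) ≈ m (D ⊓ fibre-at g-lc i)) → m C ≈ m D

  additive-Fin : ∀ n → Additive (Fin n)
  additive-Fin n f-lc g-lc C D eq =
    ≈.trans (m-sum f-lc C) (≈.trans (sum-cong-≋ eq) (≈.sym (m-sum g-lc D)))

  additive-Bool : Additive Bool
  additive-Bool f-lc g-lc C D eq = additive-Fin 2 (∘-lc bit f-lc) (∘-lc bit g-lc) C D λ i →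
    let b , bit≡i = bit-surjective i in ≈.trans
      (m-cong {C ⊓ fibre-at (∘-lc bit f-lc) i} {C ⊓ fibre-at f-lc b} (along bit≡i))
      (≈.trans (eq b) (≈.sym
        (m-cong {D ⊓ fibre-at (∘-lc bit g-lc) i} {D ⊓ fibre-at g-lc b} (along bit≡i))))
    where
    along : ∀ {f : Cantor → Bool} {P : Pred Cantor 0ℓ} {b i} → bit b ≡ i →
            (P ∩ (λ x → bit (f x) ≡ i)) ≐ (P ∩ (λ x → f x ≡ b))
    along refl = (λ (x∈P , eq) → x∈P , bit-injective eq) , λ (x∈P , eq) → x∈P , cong bit eq

  additive-× : ∀ {I J} → Additive I → Additive J → Additive (I × J)
  additive-× add-I add-J {f} {g} f-lc g-lc C D eq =
    add-I (∘-lc proj₁ f-lc) (∘-lc proj₁ g-lc) C D λ i →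
    add-J (∘-lc proj₂ f-lc) (∘-lc proj₂ g-lc)
      (C ⊓ fibre-at (∘-lc proj₁ f-lc) i) (D ⊓ fibre-at (∘-lc proj₁ g-lc) i) λ j → ≈.trans
        (m-cong {(C ⊓ fibre-at (∘-lc proj₁ f-lc) i) ⊓ fibre-at (∘-lc proj₂ f-lc) j}
          {C ⊓ fibre-at f-lc (i , j)} components)
        (≈.trans (eq (i , j)) (≈.sym
          (m-cong {(D ⊓ fibre-at (∘-lc proj₁ g-lc) i) ⊓ fibre-at (∘-lc proj₂ g-lc) j}
            {D ⊓ fibre-at g-lc (i , j)} components)))
    where
    components : ∀ {f : Cantor → _ × _} {P : Pred Cantor 0ℓ} {i j} →
      ((P ∩ (λ x → proj₁ (f x) ≡ i)) ∩ (λ x → proj₂ (f x) ≡ j)) ≐ (P ∩ (λ x → f x ≡ (i , j)))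
    components = (λ { ((x∈P , refl) , refl) → x∈P , refl }) , λ { (x∈P , refl) → (x∈P , refl) , refl }

  balanced-set : ∀ {I} → Additive I → (M : Matching I) (S : Pred I 0ℓ) →
                 m (fibre (left-lc M) S) ≈ m (fibre (right-lc M) S)
  balanced-set {I} additive M S = additive (left-lc M) (right-lc M)
    (fibre (left-lc M) S) (fibre (right-lc M) S) λ i → at i (decide (i ∈ S))
    where
    at : ∀ i → Dec (i ∈ S) → m (fibre (left-lc M) S ⊓ fibre-at (left-lc M) i) ≈
                             m (fibre (right-lc M) S ⊓ fibre-at (right-lc M) i)
    at i (yes i∈S) = ≈.trans
      (m-cong {fibre (left-lc M) S ⊓ fibre-at (left-lc M) i} {fibre-at (left-lc M) i}
        (proj₂ , λ { refl → i∈S , refl }))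
      (≈.trans (balanced M i)
        (m-cong {fibre-at (right-lc M) i} {fibre (right-lc M) S ⊓ fibre-at (right-lc M) i}
          ((λ { refl → i∈S , refl }) , proj₂)))
    at i (no i∉S) = ≈.trans (m-empty (fibre (left-lc M) S ⊓ fibre-at (left-lc M) i) λ { (x∈S , refl) → i∉S x∈S })
      (≈.sym (m-empty (fibre (right-lc M) S ⊓ fibre-at (right-lc M) i) λ { (x∈S , refl) → i∉S x∈S }))

  -- Back and forth through all coordinates

  module Exhaust (I : Set) where

    -- Step `s` adds two bits: coordinate `s` of the left point, copied to the right side, and then
    -- coordinate `s` of the right point, copied to the left side.
    Label : ℕ → Set
    Label zero    = I
    Label (suc s) = (Label s × Bool) × Bool

    truncate : ∀ {s} → Label (suc s) → Label s
    truncate = proj₁ ∘ proj₁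

    leftBit rightBit : ∀ {s} → Label (suc s) → Bool
    leftBit  = proj₂ ∘ proj₁
    rightBit = proj₂

    Compatible : (∀ s → Cantor → Label s) → Set
    Compatible u = ∀ s x → truncate (u (suc s) x) ≡ u s x

    descend : ∀ {u v} → Compatible u → Compatible v →
              ∀ {s t x y} → s ℕ.≤′ t → v t y ≡ u t x → v s y ≡ u s x
    descend u-step v-step (ℕ.≤′-reflexive refl) eq = eq
    descend u-step v-step (ℕ.≤′-step {t} s≤t) eq =
      descend u-step v-step s≤t (trans (sym (v-step t _)) (trans (cong truncate eq) (u-step t _)))

    module Follow
      (u v : ∀ s → Cantor → Label s)
      (u-lc : ∀ s → LocallyConstant (u s)) (v-lc : ∀ s → LocallyConstant (v s))
      (u-step : Compatible u) (v-step : Compatible v)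
      (read : ∀ {s} → Label (suc s) → Bool) (v-read : ∀ s y → read (v (suc s) y) ≡ y s)
      (meets : ∀ s x → ∃[ y ] v s y ≡ u s x)
      where

      -- The labels of `x` already spell out the coordinates of its partner, so the image is read
      -- off bit by bit.
      follow : Cantor → Cantor
      follow x s = read (u (suc s) x)

      labels-determine : ∀ n {x y} → v n y ≡ u n x → cylinder (follow x) n y
      labels-determine n eq i i<n =
        trans (cong read (sym (descend u-step v-step (ℕ.≤⇒≤′ i<n) eq))) (v-read i _)

      -- No single stage produces `follow x`, so it is approximated: a point `y` sharing the label
      -- of `x` at a late stage is close enough to `follow x` for `v s` to take the same value at
      -- both.
      follow-label : ∀ s x → v s (follow x) ≡ u s x
      follow-label s x =
        let n , const = radius (v-lc s) (follow x)
            y , eq    = meets (s ⊔ n) x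
        in trans (const (cylinder-mono (ℕ.m≤n⊔m s n) (labels-determine (s ⊔ n) eq)))
             (descend u-step v-step (ℕ.≤⇒≤′ (ℕ.m≤m⊔n s n)) eq)

      follow-continuous : Continuous follow
      follow-continuous n = locally λ x →
        let m , const = radius (u-lc n) x
        in m , λ {y} x~y → cylinder⇒prefix n λ i i<n →
          cong read (descend u-step u-step (ℕ.≤⇒≤′ i<n) (const x~y))

    -- Fullness makes the left fibre through `x` nonnull, and balance carries this over to the right
    -- fibre.
    nonempty-right : ∀ {J} (N : Matching J) x → ∃[ y ] right N y ≡ left N x
    nonempty-right N x = m-nonempty (fibre-at (right-lc N) (left N x)) λ m≈0 →
      m-inhabited (fibre-at (left-lc N) (left N x)) refl (≈.trans (balanced N (left N x)) m≈0)

    module Tower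
      (stage : ∀ s → Matching (Label s))
      (left-step  : Compatible (left ∘ stage))
      (right-step : Compatible (right ∘ stage))
      (left-bit   : ∀ s x → leftBit (left (stage (suc s)) x) ≡ x s)
      (right-bit  : ∀ s y → rightBit (right (stage (suc s)) y) ≡ y s)
      where

      module Forward = Follow
        (left ∘ stage) (right ∘ stage) (left-lc ∘ stage) (right-lc ∘ stage)
        left-step right-step rightBit right-bit (nonempty-right ∘ stage)

      module Backward = Follow
        (right ∘ stage) (left ∘ stage) (right-lc ∘ stage) (left-lc ∘ stage)
        right-step left-step leftBit left-bit (nonempty-right ∘ swap ∘ stage)

      forward-backward : ∀ y → Forward.follow (Backward.follow y) ≗ y
      forward-backward y s = trans (cong rightBit (Backward.follow-label (suc s) y)) (right-bit s y)

      backward-forward : ∀ x → Backward.follow (Forward.follow x) ≗ x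
      backward-forward x s = trans (cong leftBit (Forward.follow-label (suc s) x)) (left-bit s x)

      module _ (additive : Additive I) where

        additive-Label : ∀ s → Additive (Label s)
        additive-Label zero    = additive
        additive-Label (suc s) = additive-× (additive-× (additive-Label s) additive-Bool) additive-Bool

        -- Right labels of stage `n` contain the first `n` coordinates, so `D` is a union of right
        -- fibres. Its preimage is the union of the left fibres with the same labels `S`.
        preserves-determined : ∀ {n D} (det : Determined n D) (b : IsBorel (Forward.follow ⊢ D)) →
                               measure b ≈ m (determined det)
        preserves-determined {n} {D} det b = ≈.trans
          (measure-cong b _ ((λ {x} fx∈D → Forward.follow x , Forward.follow-label n x , fx∈D) , from-S _))
          (≈.trans (balanced-set (additive-Label n) (stage n) S)
            (m-cong {fibre (right-lc (stage n)) S} {determined det}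
              ((λ (y , eq , y∈D) → det (same-label eq) y∈D) , λ {y} y∈D → y , refl , y∈D)))
          where
          S : Pred (Label n) 0ℓ
          S i = ∃[ y ] (right (stage n) y ≡ i × y ∈ D)

          same-label : ∀ {x y} → right (stage n) x ≡ right (stage n) y → cylinder x n y
          same-label {x} {y} eq i i<n = trans (sym (right-bit i x)) (trans
            (cong rightBit (descend right-step right-step (ℕ.≤⇒≤′ i<n) eq)) (right-bit i y))

          from-S : ∀ x → left (stage n) x ∈ S → Forward.follow x ∈ D
          from-S x (y , eq , y∈D) = det (same-label (trans eq (sym (Forward.follow-label n x)))) y∈D

        tower-homeo : Σ[ h ∈ MeasureHomeo μ ] (∀ x → right (stage 0) (to h x) ≡ left (stage 0) x)
        tower-homeo =
          homeo Forward.follow Backward.follow Forward.follow-continuous Backward.follow-continuous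
            forward-backward backward-forward preserves-determined
          , Forward.follow-label 0

  -- Refining a matching by every coordinate, alternately on both sides, pins down a homeomorphism.
  abstract
    matching-homeo : ∀ {I} → Additive I → (M : Matching I) →
                     Σ[ h ∈ MeasureHomeo μ ] (∀ x → right M (to h x) ≡ left M x)
    matching-homeo {I} additive M = tower-homeo additive
      where
      open Exhaust I

      stage : ∀ s → Matching (Label s)
      stage zero    = M
      stage (suc s) = swap (refine (swap (refine (stage s) (coordinate-lc s))) (coordinate-lc s))

      open Tower stage (λ _ _ → refl) (λ _ _ → refl) (λ _ _ → refl) (λ _ _ → refl)

-- Clopen partitions as labellings

module _ (P : ClopenPartition) where
  open ClopenPartition P

  index : Cantor → Fin size
  index x = proj₁ (cover x)

  piece⇒index : ∀ {p x} → x ∈ set (piece p) → index x ≡ p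
  piece⇒index {p} {x} x∈p = decidable-stable (index x Fin.≟ p) λ x≢p →
    disjoint (index x) p x≢p (proj₂ (cover x) , x∈p)

  index⇒piece : ∀ {p x} → index x ≡ p → x ∈ set (piece p)
  index⇒piece {x = x} refl = proj₂ (cover x)

  index-lc : LocallyConstant index
  index-lc = locally λ x →
    let n , ⊆piece = Clopen.isOpen (piece (index x)) (proj₂ (cover x))
    in n , λ x~y → sym (piece⇒index (⊆piece x~y))

prefixPartition : ℕ → ClopenPartition
prefixPartition N = record
  { size     = 2 ^ N
  ; piece    = fibre-at (prefix-lc N)
  ; nonempty = prefix-surjective N
  ; disjoint = λ p q p≢q (x≡p , x≡q) → p≢q (trans (sym x≡p) x≡q)
  ; cover    = λ x → prefix N x , refl
  }

-- Matrices of homeomorphisms, and directedness from a dense class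

module Matrices
  (em : ExcludedMiddle (lsuc 0ℓ)) (ℝ : CompleteOrderedField) (μ : ProbabilityMeasure ℝ)
  (good : IsGood μ)
  (V : Pred (CompleteOrderedField.Carrier ℝ) 0ℓ) (values : clopenValues μ ≐ V) where

  open Classical em
  open OrderedField ℝ
  open Measure em ℝ μ
  open GoodMeasure em ℝ μ good
  open CompleteOrderedField ℝ hiding (refl; sym; trans; zero; isEquivalence)
  open ProbabilityMeasure μ renaming (measureᶜ to m; cong to measure-cong)
  open MeasureHomeo
  open ClopenPartition
  private module ≈ = CompleteOrderedField ℝ
  private module ≤ = IsTotalOrder isTotalOrder
  open import Algebra.Properties.CommutativeMonoid.Sum +-commutativeMonoid using (sum-cong-≋)
  open import Relation.Binary.Reasoning.Setoid setoid

  ∑-fibre-cong : ∀ {n k} (f : Fin n → Fin k) p {a b : Fin n → Carrier} →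
                 (∀ q → a q ≈ b q) → ∑-fibre f p a ≈ ∑-fibre f p b
  ∑-fibre-cong f p a≈b = sum-cong-≋ λ q → if-cong (does (f q Fin.≟ p)) (a≈b q)
    where
    if-cong : ∀ t {x y} → x ≈ y → (if t then x else 0#) ≈ (if t then y else 0#)
    if-cong true  x≈y = x≈y
    if-cong false _   = ≈.refl

  ⊓-comm : ∀ C D → m (C ⊓ D) ≈ m (D ⊓ C)
  ⊓-comm C D = m-cong {C ⊓ D} {D ⊓ C} (Product.swap , Product.swap)

  m-preimage : ∀ (h : MeasureHomeo μ) C → m (preimageᶜ (to-continuous h) C) ≈ m C
  m-preimage h C = preserves h (open-set (Clopen.isOpen C))

  m-piece : ∀ P p → m (piece P p) ≈ m (fibre-at (index-lc P) p)
  m-piece P p = m-cong {piece P p} {fibre-at (index-lc P) p} (piece⇒index P , index⇒piece P)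

  cell : ∀ {A : Set} {f : Cantor → A} → LocallyConstant f → MeasureHomeo μ → A → A → Clopen
  cell f-lc h a b = fibre-at f-lc a ⊓ fibre-at (∘-continuous f-lc (to-continuous h)) b

  -- `m-sum-fibre` once for each index; the swaps bring the second index into the left factor, the
  -- one being decomposed.
  cell-∑ : ∀ {n k} {r : Cantor → Fin n} (r-lc : LocallyConstant r) h (f : Fin n → Fin k) p p′ →
    m (cell (∘-lc f r-lc) h p p′) ≈ ∑-fibre f p (λ q → ∑-fibre f p′ (λ q′ → m (cell r-lc h q q′)))
  cell-∑ {r = r} r-lc h f p p′ =
    ≈.trans (m-sum-fibre r-lc f p (fibre-at (∘-continuous (∘-lc f r-lc) (to-continuous h)) p′))
    (∑-fibre-cong f p λ q → begin
      m (fibre-at r-lc q ⊓ fibre-at (∘-continuous (∘-lc f r-lc) (to-continuous h)) p′)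
        ≈⟨ m-cong {fibre-at r-lc q ⊓ fibre-at (∘-continuous (∘-lc f r-lc) (to-continuous h)) p′}
             {fibre-at (∘-lc f rh-lc) p′ ⊓ fibre-at r-lc q} (Product.swap , Product.swap) ⟩
      m (fibre-at (∘-lc f rh-lc) p′ ⊓ fibre-at r-lc q)
        ≈⟨ m-sum-fibre rh-lc f p′ (fibre-at r-lc q) ⟩
      ∑-fibre f p′ (λ q′ → m (fibre-at rh-lc q′ ⊓ fibre-at r-lc q))
        ≈⟨ ∑-fibre-cong f p′ (λ q′ → ⊓-comm (fibre-at rh-lc q′) (fibre-at r-lc q)) ⟩
      ∑-fibre f p′ (λ q′ → m (cell r-lc h q q′))   ∎)
    where
    rh-lc = ∘-continuous r-lc (to-continuous h)

  whole : Clopen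
  whole = fibre (prefix-lc 0) U

  m-fibre-∑ : ∀ {n k} {r : Cantor → Fin n} (r-lc : LocallyConstant r) (f : Fin n → Fin k) p →
    m (fibre-at (∘-lc f r-lc) p) ≈ ∑-fibre f p (λ q → m (fibre-at r-lc q))
  m-fibre-∑ r-lc f p = begin
    m (fibre-at (∘-lc f r-lc) p)                       ≈⟨ ⊓-whole (fibre-at (∘-lc f r-lc) p) ⟨
    m (fibre-at (∘-lc f r-lc) p ⊓ whole)               ≈⟨ m-sum-fibre r-lc f p whole ⟩
    ∑-fibre f p (λ q → m (fibre-at r-lc q ⊓ whole))    ≈⟨ ∑-fibre-cong f p (λ q → ⊓-whole (fibre-at r-lc q)) ⟩
    ∑-fibre f p (λ q → m (fibre-at r-lc q))            ∎
    where
    ⊓-whole : ∀ C → m (C ⊓ whole) ≈ m C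
    ⊓-whole C = m-cong {C ⊓ whole} {C} (proj₁ , λ x∈C → x∈C , _)

  homeoMatrix : ℕ → MeasureHomeo μ → Matrix μ V
  homeoMatrix N h = record
    { partition = prefixPartition N
    ; entry     = λ p p′ → m (cell (prefix-lc N) h p p′)
    ; entry∈V   = λ p p′ → proj₁ values (cell (prefix-lc N) h p p′ , ≈.refl)
    ; row-∑     = λ p → ≈.sym (m-sum ph-lc (fibre-at (prefix-lc N) p))
    -- Row sums are plain additivity, whereas column sums use that `h` preserves the measure of each
    -- cylinder.
    ; column-∑  = λ p → ≈.sym (begin
        m (fibre-at (prefix-lc N) p)    ≈⟨ m-preimage h (fibre-at (prefix-lc N) p) ⟨
        m (preimageᶜ (to-continuous h) (fibre-at (prefix-lc N) p))
          ≈⟨ m-cong {preimageᶜ (to-continuous h) (fibre-at (prefix-lc N) p)} {fibre-at ph-lc p} (id , id) ⟩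
        m (fibre-at ph-lc p)            ≈⟨ m-sum (prefix-lc N) (fibre-at ph-lc p) ⟩
        sum (λ p′ → m (fibre-at ph-lc p ⊓ fibre-at (prefix-lc N) p′))
          ≈⟨ sum-cong-≋ (λ p′ → ⊓-comm (fibre-at ph-lc p) (fibre-at (prefix-lc N) p′)) ⟩
        sum (λ p′ → m (cell (prefix-lc N) h p′ p))   ∎)
    }
    where
    ph-lc = ∘-continuous (prefix-lc N) (to-continuous h)

  sum-nonNeg : ∀ {n} (v : Fin n → Carrier) → (∀ j → 0# ≤ v j) → 0# ≤ sum v
  sum-nonNeg {zero}  v 0≤v = ≤.refl
  sum-nonNeg {suc n} v 0≤v = ≤.trans (0≤v zero) (x≤x+y (sum-nonNeg (v ∘ suc) (0≤v ∘ suc)))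

  0≤V : ∀ {v} → v ∈ V → 0# ≤ v
  0≤V v∈V = let O , v≈mO = proj₂ values v∈V in ≤.trans (nonNeg _) (≤.reflexive (≈.sym v≈mO))

  subclopen-of-measure : ∀ {v} C → v ∈ V → v ≤ m C → ∃[ W ] (set W ⊆ set C × m W ≈ v)
  subclopen-of-measure C v∈V v≤mC =
    let O , v≈mO        = proj₂ values v∈V
        W , W⊆C , mW≈mO = subclopen O C (≤.trans (≤.reflexive (≈.sym v≈mO)) v≤mC)
    in W , W⊆C , ≈.trans mW≈mO (≈.sym v≈mO)

  module Separate {n} (W : Clopen) {s : Cantor → Fin n} (s-lc : LocallyConstant s) where

    choose : Bool → Cantor → Fin (suc n)
    choose true  x = zero
    choose false x = suc (s x)

    separate : Cantor → Fin (suc n)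
    separate x = choose (indicator W x) x

    separate-lc : LocallyConstant separate
    separate-lc = dependent-lc {g = choose} (indicator-lc W) λ where
      true  → locally λ _ → 0 , λ _ → refl
      false → ∘-lc suc s-lc

    separate-in : ∀ {x} → x ∈ set W → separate x ≡ zero
    separate-in {x} x∈W = cong (λ b → choose b x) (indicator-true W x∈W)

    separate-out : ∀ {x} → x ∉ set W → separate x ≡ suc (s x)
    separate-out {x} x∉W = cong (λ b → choose b x) (¬-not (x∉W ∘ indicator-true⁻¹ W))

    separate-zero : ∀ C → set W ⊆ set C → m (C ⊓ fibre-at separate-lc zero) ≈ m W
    separate-zero C W⊆C = m-cong {C ⊓ fibre-at separate-lc zero} {W}
      ( (λ {x} (_ , eq) → decidable-stable (decide (x ∈ set W)) λ x∉W →
          contradiction (trans (sym (separate-out x∉W)) eq) λ ())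
      , λ x∈W → W⊆C x∈W , separate-in x∈W)

    separate-suc : ∀ C j → m (C ⊓ fibre-at separate-lc (suc j)) ≈ m ((C ⊓ W ᶜ) ⊓ fibre-at s-lc j)
    separate-suc C j = m-cong {C ⊓ fibre-at separate-lc (suc j)} {(C ⊓ W ᶜ) ⊓ fibre-at s-lc j}
      ( (λ {x} (x∈C , eq) → (x∈C , outside eq)
          , Fin.suc-injective (trans (sym (separate-out (outside eq))) eq))
      , λ ((x∈C , x∉W) , eq) → x∈C , trans (separate-out x∉W) (cong suc eq))
      where
      outside : ∀ {x} → separate x ≡ suc j → x ∉ set W
      outside eq x∈W = contradiction (trans (sym (separate-in x∈W)) eq) λ ()

  open Separate using (separate-lc; separate-zero; separate-suc)

  -- The labelling is defined everywhere although only its restriction to `C` matters, so that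
  -- labellings for different pieces can be glued by `dependent-lc`.
  Distribution : ∀ {n} → Clopen → (Fin n → Carrier) → Set
  Distribution {n} C v =
    Σ (Cantor → Fin n) λ s → Σ (LocallyConstant s) λ s-lc → ∀ j → m (C ⊓ fibre-at s-lc j) ≈ v j

  m-remainder : ∀ {n} (v : Fin (suc n) → Carrier) C W → set W ⊆ set C → m W ≈ v zero →
                m C ≈ sum v → m (C ⊓ W ᶜ) ≈ sum (v ∘ suc)
  m-remainder v C W W⊆C mW mC = +-cancelˡ (v zero) _ _ (begin
    v zero + m (C ⊓ W ᶜ)      ≈⟨ +-congʳ mW ⟨
    m W + m (C ⊓ W ᶜ)         ≈⟨ +-congʳ (m-cong {C ⊓ W} {W} (proj₂ , λ x∈W → W⊆C x∈W , x∈W)) ⟨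
    m (C ⊓ W) + m (C ⊓ W ᶜ)   ≈⟨ m-split C W ⟨
    m C                       ≈⟨ mC ⟩
    sum v                     ∎)

  -- A clopen set of measure `v zero` is carved off and the remainder has the sum of the other
  -- values; the last value takes all that is left. The list is nonempty because no map from the
  -- Cantor space to `Fin 0` exists.
  distribute : ∀ n (v : Fin (suc n) → Carrier) → (∀ j → v j ∈ V) → ∀ C → m C ≈ sum v → Distribution C v
  distribute zero v v∈V C mC = (λ _ → zero) , const-lc , λ where
      zero → ≈.trans (m-cong {C ⊓ fibre-at const-lc zero} {C} (proj₁ , λ x∈C → x∈C , refl))
               (≈.trans mC (+-identityʳ (v zero)))
    where
    const-lc : LocallyConstant (λ _ → zero)
    const-lc = locally λ _ → 0 , λ _ → refl
  distribute (suc n) v v∈V C mC =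
    let W , W⊆C , mW   = subclopen-of-measure C (v∈V zero)
          (≤.trans (x≤x+y (sum-nonNeg (v ∘ suc) (λ j → 0≤V (v∈V (suc j))))) (≤.reflexive (≈.sym mC)))
        s , s-lc , m-s = distribute n (v ∘ suc) (λ j → v∈V (suc j)) (C ⊓ W ᶜ)
          (m-remainder v C W W⊆C mW mC)
    in _ , separate-lc W s-lc , λ where
      zero    → ≈.trans (separate-zero W s-lc C W⊆C) mW
      (suc j) → ≈.trans (separate-suc W s-lc C j) (m-s j)

  abstract
    distribute-inhabited : ∀ {n} → Fin n → (v : Fin n → Carrier) → (∀ j → v j ∈ V) →
                           ∀ C → m C ≈ sum v → Distribution C v
    distribute-inhabited {suc n} _ = distribute n

  -- Realising a matrix, and comparing realisations

  module Realise (A : Matrix μ V) where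
    open Matrix A

    label-lc = index-lc partition

    inhabitant : Fin (size partition)
    inhabitant = index partition (λ _ → false)

    rows : ∀ p → Distribution (fibre-at label-lc p) (entry p)
    rows p = distribute-inhabited inhabitant (entry p) (entry∈V p) (fibre-at label-lc p)
      (≈.sym (≈.trans (row-∑ p) (m-piece partition p)))

    columns : ∀ p′ → Distribution (fibre-at label-lc p′) (λ p → entry p p′)
    columns p′ = distribute-inhabited inhabitant (λ p → entry p p′) (λ p → entry∈V p p′)
      (fibre-at label-lc p′) (≈.sym (≈.trans (column-∑ p′) (m-piece partition p′)))

    Pair : Set
    Pair = Fin (size partition) × Fin (size partition)

    -- The pair `(p , p′)` marks a part of `p` under `row-label` and a part of `p′` under
    -- `column-label`, both of measure `entry p p′`. A homeomorphism from the former to the latter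
    -- realises the matrix.
    row-label column-label : Cantor → Pair
    row-label    x = index partition x , proj₁ (rows (index partition x)) x
    column-label x = proj₁ (columns (index partition x)) x , index partition x

    row-label-lc : LocallyConstant row-label
    row-label-lc = dependent-lc {g = λ p x → p , proj₁ (rows p) x} label-lc
      λ p → ∘-lc (p ,_) (proj₁ (proj₂ (rows p)))

    column-label-lc : LocallyConstant column-label
    column-label-lc = dependent-lc {g = λ p x → proj₁ (columns p) x , p} label-lc
      λ p → ∘-lc (_, p) (proj₁ (proj₂ (columns p)))

    m-row-label : ∀ p p′ → m (fibre-at row-label-lc (p , p′)) ≈ entry p p′
    m-row-label p p′ = ≈.trans
      (m-cong {fibre-at row-label-lc (p , p′)}
        {fibre-at label-lc p ⊓ fibre-at (proj₁ (proj₂ (rows p))) p′}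
        ((λ { refl → refl , refl }) , λ { (refl , refl) → refl }))
      (proj₂ (proj₂ (rows p)) p′)

    m-column-label : ∀ p p′ → m (fibre-at column-label-lc (p , p′)) ≈ entry p p′
    m-column-label p p′ = ≈.trans
      (m-cong {fibre-at column-label-lc (p , p′)}
        {fibre-at label-lc p′ ⊓ fibre-at (proj₁ (proj₂ (columns p′))) p}
        ((λ { refl → refl , refl }) , λ { (refl , refl) → refl }))
      (proj₂ (proj₂ (columns p′)) p)

    labels : Matching Pair
    labels = record
      { left     = row-label
      ; right    = column-label
      ; left-lc  = row-label-lc
      ; right-lc = column-label-lc
      ; balanced = λ (p , p′) → ≈.trans (m-row-label p p′) (≈.sym (m-column-label p p′))
      }

    matched : Σ[ h ∈ MeasureHomeo μ ] (∀ x → column-label (to h x) ≡ row-label x)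
    matched = matching-homeo (additive-× (additive-Fin _) (additive-Fin _)) labels

    realise : MeasureHomeo μ
    realise = proj₁ matched

    m-realise : ∀ p p′ → m (cell label-lc realise p p′) ≈ entry p p′
    m-realise p p′ = ≈.trans
      (m-cong {cell label-lc realise p p′} {fibre-at row-label-lc (p , p′)}
        ( (λ {x} (x∈p , bx∈p′) → cong₂ _,_ x∈p (trans (cong proj₂ (sym (proj₂ matched x))) bx∈p′))
        , λ {x} eq → cong proj₁ eq , cong proj₂ (trans (proj₂ matched x) eq)))
      (m-row-label p p′)

  open Realise using (realise; m-realise) public

  infixr 8 _∙_
  _∙_ = _∘ᴴ_ μ

  _⁻¹ = inv μ

  to-from-prefix : ∀ (h : MeasureHomeo μ) n x → prefix n (to h (from h x)) ≡ prefix n x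
  to-from-prefix h n x = cylinder⇒prefix n λ i _ → to-from h x i

  -- Conjugating a realisation of B along a morphism to the matrix of h yields a homeomorphism
  -- moving prefixes only as h does, because nonempty clopen sets have nonzero measure.
  shadow : ∀ N h (B : Matrix μ V) → MatrixMorphism μ B (homeoMatrix N h) →
    Σ[ k ∈ MeasureHomeo μ ] (∀ x → ∃[ z ] (prefix N z ≡ prefix N x ×
                          prefix N (to h z) ≡ prefix N (to (k ∙ realise B ∙ k ⁻¹) x)))
  shadow N h B F = k , follow
    where
    open MatrixMorphism F using (map; measure-∑; entry-∑)

    r-lc = index-lc (Matrix.partition B)
    r    = index (Matrix.partition B)
    b    = realise B

    labels : Matching (Fin (2 ^ N))
    labels = record
      { left     = map ∘ r
      ; right    = prefix N
      ; left-lc  = ∘-lc map r-lc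
      ; right-lc = prefix-lc N
      ; balanced = λ p → ≈.trans (m-fibre-∑ r-lc map p) (≈.sym (≈.trans (measure-∑ p)
          (∑-fibre-cong map p (m-piece (Matrix.partition B)))))
      }

    matched : Σ[ k ∈ MeasureHomeo μ ] (∀ x → prefix N (to k x) ≡ map (r x))
    matched = matching-homeo (additive-Fin _) labels

    k = proj₁ matched

    m-cell : ∀ p p′ → m (cell (∘-lc map r-lc) b p p′) ≈ m (cell (prefix-lc N) h p p′)
    m-cell p p′ = ≈.trans (cell-∑ r-lc b map p p′) (≈.trans
      (∑-fibre-cong map p λ q → ∑-fibre-cong map p′ λ q′ → m-realise B q q′)
      (≈.sym (entry-∑ p p′)))

    follow : ∀ x → ∃[ z ] (prefix N z ≡ prefix N x × prefix N (to h z) ≡ prefix N (to (k ∙ b ∙ k ⁻¹) x))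
    follow x = m-nonempty (cell (prefix-lc N) h p p′) λ m≈0 →
      m-inhabited (cell (∘-lc map r-lc) b p p′) (in-p , in-p′) (≈.trans (m-cell p p′) m≈0)
      where
      p  = prefix N x
      p′ = prefix N (to (k ∙ b ∙ k ⁻¹) x)
      y  = from k x

      in-p : map (r y) ≡ p
      in-p = trans (sym (proj₂ matched y)) (to-from-prefix k N x)

      in-p′ : map (r (to b y)) ≡ p′
      in-p′ = sym (proj₂ matched (to b y))

  -- A conjugate of `g` realising `A`, seen from `g`: the conjugation is absorbed into the
  -- labelling. Two matrices thereby become labellings for one and the same `g`, which can be
  -- refined together.
  record Copy (g : MeasureHomeo μ) (A : Matrix μ V) : Set where
    open Matrix A
    field
      label    : Cantor → Fin (size partition)
      label-lc : LocallyConstant label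
      m-label  : ∀ p → m (fibre-at label-lc p) ≈ m (piece partition p)
      m-cell   : ∀ p p′ → m (cell label-lc g p p′) ≈ entry p p′

  dense⇒copy : (rokhlin : HasRokhlinProperty (Homeo μ) (IsOpenᴴ μ)) → ∀ A → Copy (proj₁ rokhlin) A
  dense⇒copy (g , dense) A = record
    { label    = e
    ; label-lc = e-lc
    ; m-label  = λ p → begin
        m (fibre-at e-lc p)
          ≈⟨ m-cong {fibre-at e-lc p} {preimageᶜ (to-continuous k) (fibre-at ι-lc p)} (id , id) ⟩
        m (preimageᶜ (to-continuous k) (fibre-at ι-lc p))   ≈⟨ m-preimage k (fibre-at ι-lc p) ⟩
        m (fibre-at ι-lc p)                                 ≈⟨ m-piece partition p ⟨
        m (piece partition p)                               ∎
    ; m-cell   = λ p p′ → begin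
        m (cell e-lc g p p′)
          ≈⟨ m-cong {cell e-lc g p p′} {preimageᶜ (to-continuous k) (cell ι-lc b p p′)}
               ( (λ {x} (x∈p , gx∈p′) → x∈p , trans (conjugate x) gx∈p′)
               , λ {x} (x∈p , bkx∈p′) → x∈p , trans (sym (conjugate x)) bkx∈p′) ⟩
        m (preimageᶜ (to-continuous k) (cell ι-lc b p p′))   ≈⟨ m-preimage k (cell ι-lc b p p′) ⟩
        m (cell ι-lc b p p′)                                 ≈⟨ m-realise A p p′ ⟩
        entry p p′                                           ∎
    }
    where
    open Matrix A

    b    = realise A
    ι    = index partition
    ι-lc = index-lc partition

    -- One condition for each piece: what `b` sends into `p` must also go into `p`. Together they
    -- force `h` and `b` to have the same labels after moving, at every point.
    constraint : Fin (size partition) → CompactOpen μ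
    constraint p = record
      { K       = λ x → ι (to b x) ≡ p
      ; O       = λ x → ι x ≡ p
      ; compact = closed⇒compact (Clopen.isClosed (fibre-at (∘-continuous ι-lc (to-continuous b)) p))
      ; isOpen  = Clopen.isOpen (fibre-at ι-lc p)
      }

    near : Pred (MeasureHomeo μ) (lsuc 0ℓ)
    near = ⋂⟦_⟧ μ (List.tabulate constraint)

    close = dense near (λ h∈ → _ , h∈ , id) (b , All.tabulate⁺ λ _ x∈K → x∈K)

    h = proj₁ close
    k = proj₁ (proj₂ (proj₂ close))

    ι-h : ∀ x → ι (to h x) ≡ ι (to b x)
    ι-h x = All.tabulate⁻ (proj₁ (proj₂ close)) (ι (to b x)) refl

    e : Cantor → Fin (size partition)
    e x = ι (to k x)

    e-lc : LocallyConstant e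
    e-lc = ∘-continuous ι-lc (to-continuous k)

    conjugate : ∀ x → ι (to b (to k x)) ≡ e (to g x)
    conjugate x = trans (sym (ι-h (to k x))) (trans
      (lc-cong ι-lc (proj₂ (proj₂ (proj₂ close)) (to k x)))
      (lc-cong (∘-continuous e-lc (to-continuous g)) (from-to k x)))

  representative : ∀ N → Fin (2 ^ N) → Cantor
  representative N q = proj₁ (prefix-surjective N q)

  prefix-representative : ∀ N q → prefix N (representative N q) ≡ q
  prefix-representative N q = proj₂ (prefix-surjective N q)

  -- At depth `N` the label factors through `prefix N`, and the factor `f` is the morphism. It is
  -- surjective because a piece is nonempty, hence nonnull, hence its label is attained.
  copy⇒morphism : ∀ {g A} (copy : Copy g A) N →
    (∀ {x y} → cylinder x N y → Copy.label copy x ≡ Copy.label copy y) →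
    MatrixMorphism μ (homeoMatrix N g) A
  copy⇒morphism {g} {A} copy N const = record
    { partitionMorphism = record
      { map        = f
      ; surjective = λ p → let x , lx≡p = label-surjective p
                           in prefix N x , λ { refl → trans (f-prefix x) lx≡p }
      ; measure-∑  = λ p → ≈.trans (≈.sym (m-label p)) (≈.trans
          (m-cong {fibre-at label-lc p} {fibre-at (∘-lc f (prefix-lc N)) p}
            ((λ {x} lx≡p → trans (f-prefix x) lx≡p) , λ {x} eq → trans (sym (f-prefix x)) eq))
          (m-fibre-∑ (prefix-lc N) f p))
      }
    ; entry-∑ = λ p p′ → ≈.trans (≈.sym (m-cell p p′)) (≈.trans
        (m-cong {cell label-lc g p p′} {cell (∘-lc f (prefix-lc N)) g p p′}
          ( (λ {x} (x∈p , gx∈p′) → trans (f-prefix x) x∈p , trans (f-prefix (to g x)) gx∈p′)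
          , λ {x} (x∈p , gx∈p′) → trans (sym (f-prefix x)) x∈p , trans (sym (f-prefix (to g x))) gx∈p′))
        (cell-∑ (prefix-lc N) g f p p′))
    }
    where
    open Copy copy
    P = Matrix.partition A

    f : Fin (2 ^ N) → Fin (size P)
    f q = label (representative N q)

    f-prefix : ∀ x → f (prefix N x) ≡ label x
    f-prefix x = const (prefix⇒cylinder N (prefix-representative N (prefix N x)))

    label-surjective : ∀ p → ∃[ x ] label x ≡ p
    label-surjective p = m-nonempty (fibre-at label-lc p) λ m≈0 →
      m-inhabited (piece P p) (proj₂ (nonempty P p)) (≈.trans (≈.sym (m-label p)) m≈0)

  rokhlin⇒directed : HasRokhlinProperty (Homeo μ) (IsOpenᴴ μ) → IsDirected (MatrixMorphism μ {V})
  rokhlin⇒directed rokhlin A₀ A₁ =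
    let copy₀       = dense⇒copy rokhlin A₀
        copy₁       = dense⇒copy rokhlin A₁
        N₀ , const₀ = uniform (Copy.label-lc copy₀)
        N₁ , const₁ = uniform (Copy.label-lc copy₁)
    in homeoMatrix (N₀ ⊔ N₁) (proj₁ rokhlin)
     , copy⇒morphism copy₀ _ (const₀ ∘ cylinder-mono (ℕ.m≤m⊔n N₀ N₁))
     , copy⇒morphism copy₁ _ (const₁ ∘ cylinder-mono (ℕ.m≤n⊔m N₀ N₁))

-- Limits of measure-preserving homeomorphisms

module Limit
  (em : ExcludedMiddle (lsuc 0ℓ)) (ℝ : CompleteOrderedField) (μ : ProbabilityMeasure ℝ) where

  open Measure em ℝ μ
  open CompleteOrderedField ℝ using (_≈_) renaming (trans to ≈-trans)
  open ProbabilityMeasure μ renaming (cong to measure-cong)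
  open MeasureHomeo

  -- Inverses are controlled too, since a uniform limit of homeomorphisms need not be invertible.
  Agree : ℕ → MeasureHomeo μ → MeasureHomeo μ → Set
  Agree n g h = (∀ x → cylinder (to g x) n (to h x)) × (∀ x → cylinder (from g x) n (from h x))

  module _ (r : ℕ → ℕ) (r-increasing : ∀ s → r s ℕ.< r (suc s)) where

    n≤r : ∀ n → n ℕ.≤ r n
    n≤r zero    = ℕ.z≤n
    n≤r (suc n) = ℕ.≤-trans (ℕ.s≤s (n≤r n)) (r-increasing n)

    r-mono : ∀ {s t} → s ℕ.≤′ t → r s ℕ.≤ r t
    r-mono (ℕ.≤′-reflexive refl) = ℕ.≤-refl
    r-mono (ℕ.≤′-step {t} s≤t)   = ℕ.≤-trans (r-mono s≤t) (ℕ.<⇒≤ (r-increasing t))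

    module Pointwise (u : ℕ → Cantor → Cantor)
      (u-step : ∀ s x → cylinder (u s x) (r s) (u (suc s) x)) where

      u-cauchy : ∀ {s t} x → s ℕ.≤′ t → cylinder (u s x) (r s) (u t x)
      u-cauchy x (ℕ.≤′-reflexive refl) = λ _ _ → refl
      u-cauchy x (ℕ.≤′-step {t} s≤t)   =
        cylinder-trans (u-cauchy x s≤t) (cylinder-mono (r-mono s≤t) (u-step t x))

      -- Coordinate `i` is final from stage `suc i` on, as `r (suc i)` exceeds `i`; `r i` might only
      -- equal `i`.
      lim : Cantor → Cantor
      lim x i = u (suc i) x i

      lim-agree : ∀ s x → cylinder (u s x) (r s) (lim x)
      lim-agree s x i i<r with ℕ.≤-total s (suc i)
      ... | inj₁ s≤1+i = u-cauchy x (ℕ.≤⇒≤′ s≤1+i) i i<r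
      ... | inj₂ 1+i≤s = sym (u-cauchy x (ℕ.≤⇒≤′ 1+i≤s) i (n≤r (suc i)))

      lim-continuous : (∀ s → IsContinuous (u s)) → Continuous lim
      lim-continuous u-cont n = locally λ x →
        let m , const = radius (continuous⁻¹ (u-cont n) n) x
        in m , λ x~y → trans (sym (same x)) (trans (const x~y) (same _))
        where
        same : ∀ x → prefix n (u n x) ≡ prefix n (lim x)
        same x = cylinder⇒prefix n (cylinder-mono (n≤r n) (lim-agree n x))

    module Inverse (u v : ℕ → Cantor → Cantor)
      (u-step : ∀ s x → cylinder (u s x) (r s) (u (suc s) x))
      (v-step : ∀ s x → cylinder (v s x) (r s) (v (suc s) x))
      (u-cont : ∀ s → IsContinuous (u s)) (uv : ∀ s x → u s (v s x) ≗ x) where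

      private
        module u = Pointwise u u-step
        module v = Pointwise v v-step

      -- At a stage `t` beyond the modulus of `u.lim` at `v.lim x`, the limit of `v` may be replaced
      -- by `v t x`, then the limit of `u` by `u t`, where the two maps cancel.
      lim-inverse : ∀ x → u.lim (v.lim x) ≗ x
      lim-inverse x i = trans
        (prefix⇒cylinder (suc i) {u.lim (v.lim x)} {u.lim (v t x)} (const (cylinder-sym
          (cylinder-mono (ℕ.≤-trans (ℕ.m≤m⊔n m (suc i)) (n≤r t)) (v.lim-agree t x)))) i ℕ.≤-refl)
        (trans (sym (u.lim-agree t (v t x) i (ℕ.≤-trans (ℕ.m≤n⊔m m (suc i)) (n≤r t)))) (uv t x i))
        where
        modulus = radius (u.lim-continuous u-cont (suc i)) (v.lim x)
        m       = proj₁ modulus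
        const   = proj₂ modulus
        t       = m ⊔ suc i

    homeo-limit : (h : ℕ → MeasureHomeo μ) → (∀ s → Agree (r s) (h s) (h (suc s))) →
                  Σ[ g ∈ MeasureHomeo μ ] (∀ s → Agree (r s) (h s) g)
    homeo-limit h h-step =
      homeo To.lim From.lim (To.lim-continuous (to-continuous ∘ h)) (From.lim-continuous (from-continuous ∘ h))
        (Inverse.lim-inverse (to ∘ h) (from ∘ h) (proj₁ ∘ h-step) (proj₂ ∘ h-step)
          (to-continuous ∘ h) (to-from ∘ h))
        (Inverse.lim-inverse (from ∘ h) (to ∘ h) (proj₂ ∘ h-step) (proj₁ ∘ h-step)
          (from-continuous ∘ h) (from-to ∘ h))
        preserves-determined
      , λ s → To.lim-agree s , From.lim-agree s
      where
      module To   = Pointwise (to ∘ h) (proj₁ ∘ h-step)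
      module From = Pointwise (from ∘ h) (proj₂ ∘ h-step)

      -- The limit agrees with `h n` on the first `n` coordinates, so `D` has the same preimage
      -- under both.
      preserves-determined : ∀ {n D} (det : Determined n D) (b : IsBorel (To.lim ⊢ D)) →
                             measure b ≈ measureᶜ (determined det)
      preserves-determined {n} det b = ≈-trans
        (measure-cong b (preimage-borel (to-continuous (h n)) (open-set (Clopen.isOpen (determined det))))
          ((λ {x} → det (cylinder-sym (agree x))) , λ {x} → det (agree x)))
        (preserves (h n) (open-set (Clopen.isOpen (determined det))))
        where
        agree : ∀ x → cylinder (to (h n) x) n (To.lim x)
        agree x = cylinder-mono (n≤r n) (To.lim-agree n x)

-- Diagonal enumeration of pairs

next : ℕ × ℕ → ℕ × ℕ
next (a , zero)  = zero , suc a
next (a , suc b) = suc a , b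

unpair : ℕ → ℕ × ℕ
unpair zero    = zero , zero
unpair (suc n) = next (unpair n)

unpair-surjective : ∀ a b → ∃[ n ] unpair n ≡ (a , b)
unpair-surjective a b = along a b (start (a ℕ.+ b))
  where
  along : ∀ a b → ∃[ n ] unpair n ≡ (zero , a ℕ.+ b) → ∃[ n ] unpair n ≡ (a , b)
  along zero    b hit = hit
  along (suc a) b (n , eq) =
    let n′ , eq′ = along a (suc b) (n , trans eq (cong (zero ,_) (sym (ℕ.+-suc a b))))
    in suc n′ , cong next eq′

  start : ∀ s → ∃[ n ] unpair n ≡ (zero , s)
  start zero    = zero , refl
  start (suc s) =
    let n , eq   = start s
        n′ , eq′ = along s zero (n , trans eq (cong (zero ,_) (sym (ℕ.+-identityʳ s))))
    in suc n′ , cong next eq′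

-- A generic homeomorphism from directedness

module Generic
  (em : ExcludedMiddle (lsuc 0ℓ)) (ℝ : CompleteOrderedField) (μ : ProbabilityMeasure ℝ)
  (good : IsGood μ)
  (V : Pred (CompleteOrderedField.Carrier ℝ) 0ℓ) (values : clopenValues μ ≐ V)
  (directed : IsDirected (MatrixMorphism μ {V})) where

  open Classical em
  open Matrices em ℝ μ good V values
  open Limit em ℝ μ
  open MeasureHomeo

  -- The task (M , N , c) prescribes the first N bits of h x in terms of the first M bits of x,
  -- by a table coded by c.
  Task : Set
  Task = ℕ × ℕ × ℕ

  Achieves : Task → MeasureHomeo μ → Set
  Achieves (M , N , c) h = Σ[ φ ∈ (Fin (2 ^ M) → Fin (2 ^ N)) ]
    (toℕ (funToFin φ) ≡ c × ∀ x → prefix N (to h x) ≡ φ (prefix M x))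

  achieves-unique : ∀ {M N c h h′} → Achieves (M , N , c) h → Achieves (M , N , c) h′ →
                    ∀ x → prefix N (to h x) ≡ prefix N (to h′ x)
  achieves-unique {M} (φ , φ-code , h≡φ) (ψ , ψ-code , h′≡ψ) x = trans (h≡φ x) (trans
    (trans (sym (Fin.finToFun-funToFin φ (prefix M x))) (trans
      (cong (λ t → finToFun t (prefix M x)) (Fin.toℕ-injective (trans φ-code (sym ψ-code))))
      (Fin.finToFun-funToFin ψ (prefix M x))))
    (sym (h′≡ψ x)))

  achieves-cong : ∀ {M N c h h′} → (∀ x → prefix N (to h′ x) ≡ prefix N (to h x)) →
                  Achieves (M , N , c) h → Achieves (M , N , c) h′
  achieves-cong h′~h (φ , φ-code , h≡φ) = φ , φ-code , λ x → trans (h′~h x) (h≡φ x)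

  some-task : ∀ N h → ∃[ M ] ∃[ c ] Achieves (M , N , c) h
  some-task N h =
    let M , const = uniform (continuous⁻¹ (to-continuous h) N)
    in M , _ , (λ q → prefix N (to h (representative M q))) , refl
     , λ x → const (cylinder-sym (prefix⇒cylinder M (prefix-representative M (prefix M x))))

  task : ℕ → Task
  task n = let M , n′ = unpair n in M , unpair n′

  task-surjective : ∀ t → ∃[ n ] task n ≡ t
  task-surjective (M , N , c) =
    let n′ , eq′ = unpair-surjective N c
        n  , eq  = unpair-surjective M n′
    in n , trans (cong (λ (M , n′) → M , unpair n′) eq) (cong (M ,_) eq′)

  -- The pair `(h , n)` stands for the neighbourhood of all `g` with `Agree n h g`; the construction
  -- shrinks such neighbourhoods.
  State : Set₁
  State = MeasureHomeo μ × ℕ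

  Achievable : Task → MeasureHomeo μ → Set₁
  Achievable t g = Σ[ k ∈ MeasureHomeo μ ] Achieves t (k ∙ g ∙ k ⁻¹)

  -- Conditional, because many tables describe no measure-preserving homeomorphism. The whole
  -- neighbourhood is quantified over so that the limit inherits the property.
  Settles : Task → State → Set₁
  Settles t (h , n) = Σ (MeasureHomeo μ) (Achieves t) → ∀ g → Agree n h g → Achievable t g

  Improvement : Task → State → Set₁
  Improvement t (h , n) =
    Σ[ (h′ , n′) ∈ State ] (n ℕ.< n′ × Agree n h h′ × Settles t (h′ , n′))

  -- What equality of matrices gives directly: `h′ x` is close to the value of `h` at some point
  -- near `x`. Uniform continuity of `h` and its inverse upgrades this to `Agree`.
  Shadow : ℕ → MeasureHomeo μ → MeasureHomeo μ → Set
  Shadow N h h′ = ∀ x → ∃[ z ] (prefix N z ≡ prefix N x × prefix N (to h z) ≡ prefix N (to h′ x))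

  shadow-to : ∀ {n N h h′} → n ℕ.≤ N → (∀ {x y} → cylinder x N y → prefix n (to h x) ≡ prefix n (to h y)) →
              Shadow N h h′ → ∀ x → cylinder (to h x) n (to h′ x)
  shadow-to {n} {N} n≤N const sh x =
    let z , z~x , hz~h′x = sh x
    in cylinder-trans (prefix⇒cylinder n (const (prefix⇒cylinder N (sym z~x))))
         (cylinder-mono n≤N (prefix⇒cylinder N hz~h′x))

  -- The shadow is taken at `from h′ w`: there `to h z` is close to `w`, so `z` is close to
  -- `from h w` by continuity of the inverse, while `z` is close to `from h′ w` by choice.
  shadow-from : ∀ {n N h h′} → n ℕ.≤ N → (∀ {x y} → cylinder x N y → prefix n (from h x) ≡ prefix n (from h y)) →
                Shadow N h h′ → ∀ w → cylinder (from h w) n (from h′ w)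
  shadow-from {n} {N} {h} {h′} n≤N const sh w =
    let z , z~x , hz~h′x = sh (from h′ w)
        hz~w = cylinder-trans (prefix⇒cylinder N hz~h′x) (λ i _ → to-from h′ w i)
    in cylinder-trans (prefix⇒cylinder n (const (cylinder-sym hz~w)))
         (cylinder-trans (λ i _ → from-to h z i) (cylinder-mono n≤N (prefix⇒cylinder N z~x)))

  shadow-radius : ∀ h n → ∃[ N ] (∀ h′ → Shadow N h h′ → Agree n h h′)
  shadow-radius h n =
    let Nₜ , constₜ = uniform (continuous⁻¹ (to-continuous h) n)
        N_f , const_f = uniform (continuous⁻¹ (from-continuous h) n)
        N   = n ⊔ (Nₜ ⊔ N_f)
        n≤N = ℕ.m≤m⊔n n (Nₜ ⊔ N_f)
        Nₜ≤N = ℕ.≤-trans (ℕ.m≤m⊔n Nₜ N_f) (ℕ.m≤n⊔m n (Nₜ ⊔ N_f))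
        N_f≤N = ℕ.≤-trans (ℕ.m≤n⊔m Nₜ N_f) (ℕ.m≤n⊔m n (Nₜ ⊔ N_f))
    in N , λ h′ sh → shadow-to {h = h} {h′} n≤N (constₜ ∘ cylinder-mono Nₜ≤N) sh
                     , shadow-from {h = h} {h′} n≤N (const_f ∘ cylinder-mono N_f≤N) sh

  -- k₁ k₀⁻¹ conjugates k₀ b k₀⁻¹ to k₁ b k₁⁻¹, and this persists for the first N bits
  -- under small perturbations of k₀ b k₀⁻¹.
  conjugation-stable : ∀ N b k₀ k₁ → ∃[ n ] (∀ g → Agree n (k₀ ∙ b ∙ k₀ ⁻¹) g →
    let k = k₁ ∙ k₀ ⁻¹ in ∀ x → prefix N (to (k ∙ g ∙ k ⁻¹) x) ≡ prefix N (to (k₁ ∙ b ∙ k₁ ⁻¹) x))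
  conjugation-stable N b k₀ k₁ =
    let n , const = uniform (∘-continuous (prefix-lc N) (to-continuous k))
    in n , λ g agree x → trans
      (sym (const (proj₁ agree (from k x))))
      (trans (lc-cong (∘-continuous (prefix-lc N) (to-continuous k₁)) (from-to k₀ _))
        (lc-cong (∘-continuous (prefix-lc N) (to-continuous (k₁ ∙ b))) (from-to k₀ (from k₁ x))))
    where
    k = k₁ ∙ k₀ ⁻¹

  improve : ∀ t σ → Improvement t σ
  improve t@(M , N , c) (h , n) with em {Σ (MeasureHomeo μ) (Achieves t)}
  ... | no impossible =
    -- The depth grows even when nothing is to be done, as the limit requires strictly increasing
    -- depths.
    (h , suc n) , ℕ.n<1+n n , ((λ _ _ _ → refl) , λ _ _ _ → refl) , λ possible → contradiction possible impossible
  ... | yes (h₁ , achieves) =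
    -- `N₀` keeps the new homeomorphism in the old neighbourhood; `N₁` makes the other conjugate of
    -- the same realisation reproduce the `N` bits of `h₁`.
    let N₀ , near₀     = shadow-radius h n
        N₁ , near₁     = shadow-radius h₁ N
        B , F₀ , F₁    = directed (homeoMatrix N₀ h) (homeoMatrix N₁ h₁)
        k₀ , sh₀       = shadow N₀ h B F₀
        k₁ , sh₁       = shadow N₁ h₁ B F₁
        n′ , stable    = conjugation-stable N (realise B) k₀ k₁
    in (k₀ ∙ realise B ∙ k₀ ⁻¹ , suc n ⊔ n′)
     , ℕ.m≤m⊔n (suc n) n′
     , near₀ (k₀ ∙ realise B ∙ k₀ ⁻¹) sh₀
     , λ _ g (agreeₜ , agree_f) → k₁ ∙ k₀ ⁻¹ ,
       achieves-cong {M} {N} {c} {h₁} {(k₁ ∙ k₀ ⁻¹) ∙ g ∙ (k₁ ∙ k₀ ⁻¹) ⁻¹}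
         (λ x → trans
           (stable g ( (λ y → cylinder-mono (ℕ.m≤n⊔m (suc n) n′) (agreeₜ y))
                     , λ y → cylinder-mono (ℕ.m≤n⊔m (suc n) n′) (agree_f y)) x)
           (sym (cylinder⇒prefix N (proj₁ (near₁ (k₁ ∙ realise B ∙ k₁ ⁻¹) sh₁) x))))
         achieves

  states : ℕ → State
  states zero    = idᴴ μ , 0
  states (suc s) = proj₁ (improve (task s) (states s))

  generic : Σ[ g ∈ MeasureHomeo μ ] (∀ s → Agree (proj₂ (states s)) (proj₁ (states s)) g)
  generic = homeo-limit (proj₂ ∘ states)
    (λ s → proj₁ (proj₂ (improve (task s) (states s))))
    (proj₁ ∘ states)
    (λ s → proj₁ (proj₂ (proj₂ (improve (task s) (states s)))))

  generic-achieves : ∀ t → Σ (MeasureHomeo μ) (Achieves t) → Achievable t (proj₁ generic)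
  generic-achieves t possible with s , refl ← task-surjective t =
    proj₂ (proj₂ (proj₂ (improve (task s) (states s)))) possible (proj₁ generic) (proj₂ generic (suc s))

  -- A Lebesgue number: the open sets of points whose image has its `n`-cylinder inside `O` cover
  -- the compact set, and the largest `n` in a finite subcover works for all of its points.
  compact-open-radius : ∀ (S : CompactOpen μ) h → h ∈ ⟦_⟧ μ S →
    ∃[ N ] (∀ h′ → (∀ x → cylinder (to h x) N (to h′ x)) → h′ ∈ ⟦_⟧ μ S)
  compact-open-radius S h h∈S =
    let ns , covers = compact ℕ inner inner-open λ x∈K → isOpen (h∈S x∈K)
    in List.foldr _⊔_ 0 ns , λ h′ h~h′ {x} x∈K → inside ns (covers x∈K) (h~h′ x)
    where
    open CompactOpen S

    inner : ℕ → Pred Cantor 0ℓ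
    inner n x = cylinder (to h x) n ⊆ O

    inner-open : ∀ n → IsOpen (inner n)
    inner-open n {x} x∈ =
      let m , const = radius (continuous⁻¹ (to-continuous h) n) x
      in m , λ x~y y~z → x∈ (cylinder-trans (prefix⇒cylinder n (const x~y)) y~z)

    inside : ∀ ns {x y} → Any (λ n → x ∈ inner n) ns → cylinder (to h x) (List.foldr _⊔_ 0 ns) y → y ∈ O
    inside (n ∷ ns) (here ⊆O)  hx~y = ⊆O (cylinder-mono (ℕ.m≤m⊔n n _) hx~y)
    inside (n ∷ ns) (there x∈) hx~y = inside ns x∈ (cylinder-mono (ℕ.m≤n⊔m n _) hx~y)

  basic-open-radius : ∀ Ss h → h ∈ ⋂⟦_⟧ μ Ss →
    ∃[ N ] (∀ h′ → (∀ x → cylinder (to h x) N (to h′ x)) → h′ ∈ ⋂⟦_⟧ μ Ss)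
  basic-open-radius []       h []          = 0 , λ _ _ → []
  basic-open-radius (S ∷ Ss) h (h∈S ∷ h∈Ss) =
    let m , near  = compact-open-radius S h h∈S
        n , nears = basic-open-radius Ss h h∈Ss
    in m ⊔ n , λ h′ h~h′ → near h′ (λ x → cylinder-mono (ℕ.m≤m⊔n m n) (h~h′ x))
                         ∷ nears h′ (λ x → cylinder-mono (ℕ.m≤n⊔m m n) (h~h′ x))

  directed⇒rokhlin : HasRokhlinProperty (Homeo μ) (IsOpenᴴ μ)
  directed⇒rokhlin = proj₁ generic , λ 𝒪 𝒪-open (h , h∈𝒪) →
    let Ss , h∈Ss , Ss⊆𝒪 = 𝒪-open h∈𝒪
        N , near         = basic-open-radius Ss h h∈Ss
        -- The target `h` itself witnesses that the table of its first `N` bits is achievable, so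
        -- some conjugate of the generic element has that table too.
        M , c , achieves = some-task N h
        k , achieves′    = generic-achieves (M , N , c) (h , achieves)
        h′               = k ∙ proj₁ generic ∙ k ⁻¹
    in h′
     , Ss⊆𝒪 (near h′ λ x → prefix⇒cylinder N (achieves-unique {M} {N} {c} {h} {h′} achieves achieves′ x))
     , k , λ _ _ → refl

theorem4p8 : ExcludedMiddle (lsuc 0ℓ) →
    (ℝ : CompleteOrderedField) →
    (V : Pred (CompleteOrderedField.Carrier ℝ) 0ℓ) → IsGroupLike ℝ V →
    (μ : ProbabilityMeasure ℝ) → IsGood μ → clopenValues μ ≐ V →
    IsDirected (MatrixMorphism μ {V}) ⇔ HasRokhlinProperty (Homeo μ) (IsOpenᴴ μ)
theorem4p8 em ℝ V _ μ good values = mk⇔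
  (Generic.directed⇒rokhlin em ℝ μ good V values)
  (Matrices.rokhlin⇒directed em ℝ μ good V values)
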